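{- Let $\mathcal{T}$ be an smc theory. For any proof net $f:A\to B$ in $S(\mathcal{T})$ with set of cells $C$, and any partition of $C$ into two sets $C_1$ and $C_2$, there are a formula $D$ and proof nets $f_1:A\to D$ and $f_2:D\to B$ in $S(\mathcal{T})$ such that $f = f_2\circ f_1$ and each $f_i$ ($i=1,2$) contains exactly the cells in $C_i$.
   Context: For a set $X$, $\mathcal{F}(X)$ is the set of formulae $A,B ::= x \mid I \mid A\otimes B \mid A\multimap B$ with $x\in X$. An smc (symmetric monoidal closed) signature $\Sigma$ is a set $X$ of sorts together with a directed multigraph whose vertex set is $\mathcal{F}(X)$; an edge $c:A\to B$ is called an operation. The category $S(\Sigma)$. A port of a formula is an occurrence in it of a sort or of $I$; it is positive if it lies to the left of an even number of $\multimap$'s in the abstract syntax tree (i.e. in the antecedents of an even number of implications), negative otherwise. Given formulae $A,B$, a linking $A\to B$ over $\Sigma$ consists of a finite set of cells, each labelled by an operation $c:A_c\to B_c$ of $\Sigma$, and a partial function (whose graph consists of "wires") from the globally negative to the globally positive ports among the ports of $A$, of $B$, and of $A_c$ and $B_c$ for each cell. Here ports of $B$ and of the $A_c$ have as global polarity their polarity in the formula, and ports of $A$ and of the $B_c$ have the opposite one. It is required that for each sort $a$ the function restricts to a bijection from the negative $a$ ports to the positive $a$ ports; negative $I$ ports may be sent to positive ports of any type, with no injectivity requirement. Linkings are taken up to the choice (renaming) of the set of cells. Formulae are viewed as formulae of classical multiplicative linear logic (with connectives $x,x^\bot,I,\bot,\otimes,⅋$ and de Morgan duality $(-)^\bot$)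 by encoding $A\multimap B$ as $A^\bot\mathbin{⅋} B$. A switching of a classical formula is its abstract syntax tree in which exactly one argument edge of each $⅋$ has been removed. A switching of a linking $A\to B$ is the undirected graph obtained by glueing, along ports, the (undirected) wires with a switching of $A^\bot$, a switching of $B$, and, for each cell $c:A_c\to B_c$, a switching of $A_c\otimes B_c^\bot$. A linking is correct if its function is total and all its switchings are acyclic and connected. Linkings compose by glueing along the ports of the middle formula (the cells of the composite being the disjoint union of the cells), and correctness is preserved. A rewiring of a correct linking is any correct linking obtained from it by changing the target of exactly one wire whose source is an occurrence of $I$. $S(\Sigma)$ has as objects the formulae in $\mathcal{F}(X)$ and as morphisms the correct linkings modulo the equivalence relation generated by rewiring, with the evident smc structure; it is the free smc category on $\Sigma$. An smc theory $\mathcal{T}=(\Sigma,E)$ is an smc signature $\Sigma$ together with, for all formulae $A,B$, a set $E_{A,B}$ of equations, i.e. of pairs of morphisms in $S(\Sigma)(A,B)$. $S(\mathcal{T})$ is the quotient of $S(\Sigma)$ by the equivalence relation generated by: $f_1\sim f_2:C\to D$ if there are $A,B$, $(g_1,g_2)\in E_{A,B}$ and $f:(A\multimap B)\otimes C\to D$ with $f_i = \big(C\cong I\otimes C\xrightarrow{\ulcorner g_i\urcorner\otimes C}(A\multimap B)\otimes C\xrightarrow{f}D\big)$ for $i=1,2$, where $\ulcorner g\urcorner:I\to(A\multimap B)$ is the currying of $g:A\to B$. A proof net in $S(\mathcal{T})$ with set of cells $C$ is a morphism of $S(\mathcal{T})$ presented by a correct linking over $\Sigma$ whose set of cells is $C$;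 the equality $f=f_2\circ f_1$ is an equality of morphisms of $S(\mathcal{T})$. -}

module Defs where

open import Data.Empty using (⊥)
open import Data.Fin using (Fin)
open import Data.Fin.Subset using (Subset; _∈_)
open import Data.List using (List; []; _∷_)
open import Data.List.Relation.Unary.Unique.Propositional using (Unique)
open import Data.Maybe using (Maybe; just)
open import Data.Nat using (ℕ)
open import Data.Product using (Σ-syntax; ∃; ∃-syntax; ∃₂; _×_; _,_; proj₁; proj₂)
open import Data.Sign using (Sign; opposite) renaming (+ to ⁺; - to ⁻)
open import Data.Sum using (_⊎_; inj₁; inj₂; [_,_])
open import Function.Bundles using (_↔_; _⇔_; Inverse)
open import Relation.Binary.Construct.Closure.Equivalence using (EqClosure)
open import Relation.Binary.PropositionalEquality using (_≡_; _≢_; subst)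
open import Relation.Nullary using (¬_)

------------------------------------------------------------------------
-- Undirected multigraphs

record Graph : Set₁ where
  field
    Vertex : Set
    Edge   : Set
    ends   : Edge → Vertex × Vertex

  Joins : Edge → Vertex → Vertex → Set
  Joins e u v = ends e ≡ (u , v) ⊎ ends e ≡ (v , u)

  data Walk : Vertex → Vertex → Set where
    []   : ∀ {u} → Walk u u
    step : ∀ {u v w} (e : Edge) → Joins e u v → Walk v w → Walk u w

  edges : ∀ {u v} → Walk u v → List Edge
  edges []           = []
  edges (step e _ w) = e ∷ edges w

  -- The final vertex is left out, so that on a closed walk the base point is
  -- listed once.
  vertices : ∀ {u v} → Walk u v → List Vertex
  vertices []               = []
  vertices (step {u} _ _ w) = u ∷ vertices w

  IsCycle : ∀ {v} → Walk v v → Set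
  IsCycle w = edges w ≢ [] × Unique (edges w) × Unique (vertices w)

  Acyclic : Set
  Acyclic = ∀ {v} (w : Walk v v) → ¬ IsCycle w

  Connected : Set
  Connected = ∀ u v → Walk u v

------------------------------------------------------------------------
-- Formulae and their ports

infixr 7 _⊗_
infixr 6 _⊸_

data Formula (X : Set) : Set where
  var     : X → Formula X
  I       : Formula X
  _⊗_ _⊸_ : Formula X → Formula X → Formula X

data Atom (X : Set) : Set where
  sort : X → Atom X
  unit : Atom X

-- Port A s t: the occurrences of t in A having polarity s.
data Port {X : Set} : Formula X → Sign → Atom X → Set where
  var : ∀ {x} → Port (var x) ⁺ (sort x)
  I   : Port I ⁺ unit
  ⊗ˡ  : ∀ {A B s t} → Port A s t → Port (A ⊗ B) s t
  ⊗ʳ  : ∀ {A B s t} → Port B s t → Port (A ⊗ B) s t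
  ⊸ˡ  : ∀ {A B s t} → Port A (opposite s) t → Port (A ⊸ B) s t
  ⊸ʳ  : ∀ {A B s t} → Port B s t → Port (A ⊸ B) s t

head : {X : Set} (A : Formula X) → ∃ (Port A ⁺)
head (var x) = sort x , var
head I       = unit , I
head (A ⊗ B) = proj₁ (head B) , ⊗ʳ (proj₂ (head B))
head (A ⊸ B) = proj₁ (head B) , ⊸ʳ (proj₂ (head B))

------------------------------------------------------------------------
-- Classical formulae and their switchings

data Connective : Set where
  tensor par : Connective

dualᶜ : Connective → Connective
dualᶜ tensor = par
dualᶜ par    = tensor

-- The literals x, x^⊥, I and ⊥ are lit ⁺ (sort x), lit ⁻ (sort x),
-- lit ⁺ unit and lit ⁻ unit.
data Classical (X : Set) : Set where
  lit   : Sign → Atom X → Classical X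
  _⟨_⟩_ : Classical X → Connective → Classical X → Classical X

dual : {X : Set} → Classical X → Classical X
dual (lit s t)   = lit (opposite s) t
dual (P ⟨ c ⟩ Q) = dual P ⟨ dualᶜ c ⟩ dual Q

⟦_⟧ : {X : Set} → Formula X → Classical X
⟦ var x ⟧ = lit ⁺ (sort x)
⟦ I ⟧     = lit ⁺ unit
⟦ A ⊗ B ⟧ = ⟦ A ⟧ ⟨ tensor ⟩ ⟦ B ⟧
⟦ A ⊸ B ⟧ = dual ⟦ A ⟧ ⟨ par ⟩ ⟦ B ⟧

-- Nodes of the abstract syntax tree.
data Node {X : Set} : Classical X → Set where
  root  : ∀ {P} → Node P
  left  : ∀ {P c Q} → Node P → Node (P ⟨ c ⟩ Q)
  right : ∀ {P c Q} → Node Q → Node (P ⟨ c ⟩ Q)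

dualNode : {X : Set} {P : Classical X} → Node P → Node (dual P)
dualNode root      = root
dualNode (left n)  = left (dualNode n)
dualNode (right n) = right (dualNode n)

leaf : {X : Set} {A : Formula X} {s : Sign} {t : Atom X} → Port A s t → Node ⟦ A ⟧
leaf var    = root
leaf I      = root
leaf (⊗ˡ p) = left (leaf p)
leaf (⊗ʳ p) = right (leaf p)
leaf (⊸ˡ p) = left (dualNode (leaf p))
leaf (⊸ʳ p) = right (leaf p)

data Side : Set where
  leftSide rightSide : Side

data Choice : Connective → Set where
  both : Choice tensor
  only : Side → Choice par

data Kept : {c : Connective} → Choice c → Side → Set where
  both : ∀ {i} → Kept both i
  only : ∀ {i} → Kept (only i) i

data Switching {X : Set} : Classical X → Set where
  lit    : ∀ {s t} → Switching (lit s t)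
  choose : ∀ {P c Q} → Choice c → Switching P → Switching Q → Switching (P ⟨ c ⟩ Q)

-- Argument edges of the abstract syntax tree which the switching retains.
data TreeEdge {X : Set} : {P : Classical X} → Switching P → Set where
  here  : ∀ {P c Q} {k : Choice c} {σ : Switching P} {τ : Switching Q} (i : Side) →
          Kept k i → TreeEdge (choose k σ τ)
  left  : ∀ {P c Q} {k : Choice c} {σ : Switching P} {τ : Switching Q} →
          TreeEdge σ → TreeEdge (choose k σ τ)
  right : ∀ {P c Q} {k : Choice c} {σ : Switching P} {τ : Switching Q} →
          TreeEdge τ → TreeEdge (choose k σ τ)

parent child : {X : Set} {P : Classical X} {σ : Switching P} → TreeEdge σ → Node P
parent (here _ _) = root
parent (left e)   = left (parent e)
parent (right e)  = right (parent e)
child (here leftSide _)  = left root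
child (here rightSide _) = right root
child (left e)           = left (child e)
child (right e)          = right (child e)

------------------------------------------------------------------------
-- Signatures

record Signature : Set₁ where
  field
    Sort : Set
    Op   : Formula Sort → Formula Sort → Set

module _ (S : Signature) where
  open Signature S

  record Operation : Set where
    constructor operation
    field
      {source target} : Formula Sort
      op              : Op source target

open Operation

module ProofNets (S : Signature) where
  open Signature S

  Fml : Set
  Fml = Formula Sort

  ----------------------------------------------------------------------
  -- Linkings

  -- The ports of a linking A → B with the given cells, by global polarity.
  data GPort (A B : Fml) {C : Set} (label : C → Operation S) (s : Sign) (t : Atom Sort) : Set where
    dom : Port A (opposite s) t → GPort A B label s t
    cod : Port B s t → GPort A B label s t
    arg : (c : C) → Port (source (label c)) s t → GPort A B label s t
    res : (c : C) → Port (target (label c)) (opposite s) t → GPort A B label s t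

  -- The partial function of a linking, split by source: it restricts to a bijection on
  -- the ports of each sort, so only negative unit ports may be unwired.
  record Linking (A B : Fml) {n : ℕ} (label : Fin n → Operation S) : Set where
    field
      sorts : ∀ a → GPort A B label ⁻ (sort a) ↔ GPort A B label ⁺ (sort a)
      units : GPort A B label ⁻ unit → Maybe (∃[ t ] GPort A B label ⁺ t)

    data Wire : ∀ {t u} → GPort A B label ⁻ t → GPort A B label ⁺ u → Set where
      sort : ∀ {a} {p : GPort A B label ⁻ (sort a)} {q : GPort A B label ⁺ (sort a)} →
             Inverse.to (sorts a) p ≡ q → Wire p q
      unit : ∀ {u} {p : GPort A B label ⁻ unit} {q : GPort A B label ⁺ u} →
             units p ≡ just (u , q) → Wire p q

    Total : Set
    Total = ∀ {t} (p : GPort A B label ⁻ t) → ∃[ u ] ∃[ q ] Wire {t} {u} p q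

    data Vertex : Set where
      dom  : Node (dual ⟦ A ⟧) → Vertex
      cod  : Node ⟦ B ⟧ → Vertex
      cell : (c : Fin n) →
             Node (⟦ source (label c) ⟧ ⟨ tensor ⟩ dual ⟦ target (label c) ⟧) → Vertex

    vertex : ∀ {s t} → GPort A B label s t → Vertex
    vertex (dom p)   = dom (dualNode (leaf p))
    vertex (cod p)   = cod (leaf p)
    vertex (arg c p) = cell c (left (leaf p))
    vertex (res c p) = cell c (right (dualNode (leaf p)))

    record LinkingSwitching : Set where
      field
        domσ  : Switching (dual ⟦ A ⟧)
        codσ  : Switching ⟦ B ⟧
        cellσ : (c : Fin n) →
                Switching (⟦ source (label c) ⟧ ⟨ tensor ⟩ dual ⟦ target (label c) ⟧)

    module _ (σ : LinkingSwitching) where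
      open LinkingSwitching σ

      data SwitchedEdge : Set where
        dom  : TreeEdge domσ → SwitchedEdge
        cod  : TreeEdge codσ → SwitchedEdge
        cell : (c : Fin n) → TreeEdge (cellσ c) → SwitchedEdge
        wire : ∀ {t u} {p : GPort A B label ⁻ t} {q : GPort A B label ⁺ u} →
               Wire p q → SwitchedEdge

      switchedEnds : SwitchedEdge → Vertex × Vertex
      switchedEnds (dom e)            = dom (parent e) , dom (child e)
      switchedEnds (cod e)            = cod (parent e) , cod (child e)
      switchedEnds (cell c e)         = cell c (parent e) , cell c (child e)
      switchedEnds (wire {p = p} {q} _) = vertex p , vertex q

      switchedGraph : Graph
      switchedGraph = record { Vertex = Vertex ; Edge = SwitchedEdge ; ends = switchedEnds }

    record Correct : Set where
      field
        total     : Total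
        acyclic   : ∀ σ → Graph.Acyclic (switchedGraph σ)
        connected : ∀ σ → Graph.Connected (switchedGraph σ)

  record Rewiring {A B : Fml} {n : ℕ} {label : Fin n → Operation S}
                  (f g : Linking A B label) : Set where
    open Linking
    field
      sorts-agree : ∀ a p → Inverse.to (sorts f a) p ≡ Inverse.to (sorts g a) p
      changed     : GPort A B label ⁻ unit
      differ      : units f changed ≢ units g changed
      units-agree : ∀ p → p ≢ changed → units f p ≡ units g p

  record ProofNet (A B : Fml) : Set where
    constructor proofNet
    field
      {size}  : ℕ
      {label} : Fin size → Operation S
      linking : Linking A B label
      correct : Linking.Correct linking

  ----------------------------------------------------------------------
  -- Diagrams: linkings without any condition on their cells and wires, on which
  -- the operations of the smc structure are computed

  record Diagram (A B : Fml) : Set₁ where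
    field
      Cell  : Set
      label : Cell → Operation S

    DPort : Sign → Atom Sort → Set
    DPort = GPort A B label

    field
      Wire : ∀ {t u} → DPort ⁻ t → DPort ⁺ u → Set

  open Diagram

  diagram : ∀ {A B} → ProofNet A B → Diagram A B
  diagram f = record
    { Cell  = Fin (ProofNet.size f)
    ; label = ProofNet.label f
    ; Wire  = Linking.Wire (ProofNet.linking f)
    }

  rename : ∀ {A B C C′} {ℓ : C → Operation S} {ℓ′ : C′ → Operation S} (h : C → C′) →
           (∀ c → ℓ c ≡ ℓ′ (h c)) → ∀ {s t} → GPort A B ℓ s t → GPort A B ℓ′ s t
  rename h eq (dom p)           = dom p
  rename h eq (cod p)           = cod p
  rename h eq {s} {t} (arg c p) = arg (h c) (subst (λ o → Port (source o) s t) (eq c) p)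
  rename h eq {s} {t} (res c p) = res (h c) (subst (λ o → Port (target o) (opposite s) t) (eq c) p)

  infix 4 _≅_

  -- Equality up to the choice of the set of cells.
  record _≅_ {A B : Fml} (d e : Diagram A B) : Set where
    field
      cells  : Cell d ↔ Cell e
      labels : ∀ c → label d c ≡ label e (Inverse.to cells c)
      wires  : ∀ {t u} (p : DPort d ⁻ t) (q : DPort d ⁺ u) →
               Wire d p q ⇔ Wire e (rename (Inverse.to cells) labels p)
                                   (rename (Inverse.to cells) labels q)

  noCells : ⊥ → Operation S
  noCells ()

  data IdWire {A : Fml} : ∀ {t u} → GPort A A noCells ⁻ t → GPort A A noCells ⁺ u → Set where
    forth : ∀ {t} (p : Port A ⁺ t) → IdWire (dom p) (cod p)
    back  : ∀ {t} (p : Port A ⁻ t) → IdWire (cod p) (dom p)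

  idᵈ : ∀ {A} → Diagram A A
  idᵈ = record { Cell = ⊥ ; label = noCells ; Wire = IdWire }

  -- The inverse left unitor.
  data UnitorWire {A : Fml} :
       ∀ {t u} → GPort A (I ⊗ A) noCells ⁻ t → GPort A (I ⊗ A) noCells ⁺ u → Set where
    forth : ∀ {t} (p : Port A ⁺ t) → UnitorWire (dom p) (cod (⊗ʳ p))
    back  : ∀ {t} (p : Port A ⁻ t) → UnitorWire (cod (⊗ʳ p)) (dom p)

  unitorᵈ : ∀ {A} → Diagram A (I ⊗ A)
  unitorᵈ = record { Cell = ⊥ ; label = noCells ; Wire = UnitorWire }

  module _ {A B D : Fml} (g : Diagram D B) (f : Diagram A D) where

    glueLabel : Cell f ⊎ Cell g → Operation S
    glueLabel = [ label f , label g ]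

    -- Ports of f, respectively g, other than those of the middle formula.
    data Outerᶠ {s : Sign} {t : Atom Sort} : DPort f s t → GPort A B glueLabel s t → Set where
      dom : (p : Port A (opposite s) t) → Outerᶠ (dom p) (dom p)
      arg : ∀ c (p : Port (source (label f c)) s t) → Outerᶠ (arg c p) (arg (inj₁ c) p)
      res : ∀ c (p : Port (target (label f c)) (opposite s) t) → Outerᶠ (res c p) (res (inj₁ c) p)

    data Outerᵍ {s : Sign} {t : Atom Sort} : DPort g s t → GPort A B glueLabel s t → Set where
      cod : (p : Port B s t) → Outerᵍ (cod p) (cod p)
      arg : ∀ c (p : Port (source (label g c)) s t) → Outerᵍ (arg c p) (arg (inj₂ c) p)
      res : ∀ c (p : Port (target (label g c)) (opposite s) t) → Outerᵍ (res c p) (res (inj₂ c) p)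

    -- Pathᶠ p r: alternately following wires of f and g through the middle formula,
    -- starting with the wire of f at p, leads to the outer port r; Pathᵍ likewise.
    mutual
      data Pathᶠ {t v} (p : DPort f ⁻ t) (r : GPort A B glueLabel ⁺ v) : Set where
        stop  : ∀ {q : DPort f ⁺ v} → Wire f p q → Outerᶠ q r → Pathᶠ p r
        cross : ∀ {u} {d : Port D ⁺ u} → Wire f p (cod d) → Pathᵍ (dom d) r → Pathᶠ p r

      data Pathᵍ {t v} (p : DPort g ⁻ t) (r : GPort A B glueLabel ⁺ v) : Set where
        stop  : ∀ {q : DPort g ⁺ v} → Wire g p q → Outerᵍ q r → Pathᵍ p r
        cross : ∀ {u} {d : Port D ⁻ u} → Wire g p (dom d) → Pathᶠ (cod d) r → Pathᵍ p r

    data GlueWire {t v} (p : GPort A B glueLabel ⁻ t) (r : GPort A B glueLabel ⁺ v) : Set where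
      fromᶠ : ∀ {p′ : DPort f ⁻ t} → Outerᶠ p′ p → Pathᶠ p′ r → GlueWire p r
      fromᵍ : ∀ {p′ : DPort g ⁻ t} → Outerᵍ p′ p → Pathᵍ p′ r → GlueWire p r

  infixr 9 _∘ᵈ_

  _∘ᵈ_ : ∀ {A B D} → Diagram D B → Diagram A D → Diagram A B
  g ∘ᵈ f = record { Cell = Cell f ⊎ Cell g ; label = glueLabel g f ; Wire = GlueWire g f }

  module _ {A B A′ B′ : Fml} (f : Diagram A B) (g : Diagram A′ B′) where

    tensorLabel : Cell f ⊎ Cell g → Operation S
    tensorLabel = [ label f , label g ]

    embedˡ : ∀ {s t} → DPort f s t → GPort (A ⊗ A′) (B ⊗ B′) tensorLabel s t
    embedˡ (dom p)   = dom (⊗ˡ p)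
    embedˡ (cod p)   = cod (⊗ˡ p)
    embedˡ (arg c p) = arg (inj₁ c) p
    embedˡ (res c p) = res (inj₁ c) p

    embedʳ : ∀ {s t} → DPort g s t → GPort (A ⊗ A′) (B ⊗ B′) tensorLabel s t
    embedʳ (dom p)   = dom (⊗ʳ p)
    embedʳ (cod p)   = cod (⊗ʳ p)
    embedʳ (arg c p) = arg (inj₂ c) p
    embedʳ (res c p) = res (inj₂ c) p

    data TensorWire : ∀ {t u} → GPort (A ⊗ A′) (B ⊗ B′) tensorLabel ⁻ t →
                                GPort (A ⊗ A′) (B ⊗ B′) tensorLabel ⁺ u → Set where
      left  : ∀ {t u} {p : DPort f ⁻ t} {q : DPort f ⁺ u} →
              Wire f p q → TensorWire (embedˡ p) (embedˡ q)
      right : ∀ {t u} {p : DPort g ⁻ t} {q : DPort g ⁺ u} →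
              Wire g p q → TensorWire (embedʳ p) (embedʳ q)

  infixr 7 _⊗ᵈ_

  _⊗ᵈ_ : ∀ {A B A′ B′} → Diagram A B → Diagram A′ B′ → Diagram (A ⊗ A′) (B ⊗ B′)
  f ⊗ᵈ g = record { Cell = Cell f ⊎ Cell g ; label = tensorLabel f g ; Wire = TensorWire f g }

  module _ {A B : Fml} (g : Diagram A B) where

    curryPort : ∀ {s t} → DPort g s t → GPort I (A ⊸ B) (label g) s t
    curryPort (dom p)   = cod (⊸ˡ p)
    curryPort (cod p)   = cod (⊸ʳ p)
    curryPort (arg c p) = arg c p
    curryPort (res c p) = res c p

    -- The domain I is a negative port, whose wire may have any target: all choices are
    -- rewirings of one another.
    data NameWire : ∀ {t u} → GPort I (A ⊸ B) (label g) ⁻ t →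
                              GPort I (A ⊸ B) (label g) ⁺ u → Set where
      curry : ∀ {t u} {p : DPort g ⁻ t} {q : DPort g ⁺ u} →
              Wire g p q → NameWire (curryPort p) (curryPort q)
      unit  : NameWire (dom I) (cod (⊸ʳ (proj₂ (head B))))

  ⌜_⌝ᵈ : ∀ {A B} → Diagram A B → Diagram I (A ⊸ B)
  ⌜ g ⌝ᵈ = record { Cell = Cell g ; label = label g ; Wire = NameWire g }

  ----------------------------------------------------------------------
  -- Equality of morphisms of the free smc category

  data FreeStep {A B : Fml} : ProofNet A B → ProofNet A B → Set where
    relabel : ∀ {f g} → diagram f ≅ diagram g → FreeStep f g
    rewire  : ∀ {n} {label : Fin n → Operation S} {f g : Linking A B label}
               {cf : Linking.Correct f} {cg : Linking.Correct g} →
               Rewiring f g → FreeStep (proofNet f cf) (proofNet g cg)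

  infix 4 _≈Σ_

  _≈Σ_ : ∀ {A B} → ProofNet A B → ProofNet A B → Set
  _≈Σ_ = EqClosure FreeStep

  -- f equals, modulo _≈_, the morphism presented by d. Composites of correct linkings
  -- are correct, so this is the meaning of f = d for d composed from proof nets.
  EqualsDiagram : ∀ {A B} → (ProofNet A B → ProofNet A B → Set) →
                  ProofNet A B → Diagram A B → Set
  EqualsDiagram _≈_ f d = ∃[ h ] diagram h ≅ d × f ≈ h

  -- The set of cells of g is the subset C of the cells of f, up to renaming.
  HasExactlyCells : ∀ {A B A′ B′} (f : ProofNet A B) → Subset (ProofNet.size f) →
                    ProofNet A′ B′ → Set
  HasExactlyCells f C g =
    Σ[ ι ∈ Fin (ProofNet.size g) ↔ ∃ (_∈ C) ]
      (∀ c → ProofNet.label g c ≡ ProofNet.label f (proj₁ (Inverse.to ι c)))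

------------------------------------------------------------------------
-- Theories

record Theory : Set₁ where
  field
    signature : Signature

  open Signature signature public
  open ProofNets signature public

  field
    Equation : ∀ A B → ProofNet A B → ProofNet A B → Set

  data TheoryStep {C D : Fml} : ProofNet C D → ProofNet C D → Set where
    free     : ∀ {f₁ f₂} → f₁ ≈Σ f₂ → TheoryStep f₁ f₂
    equation : ∀ {A B} {g₁ g₂ : ProofNet A B} {f₁ f₂ : ProofNet C D} → Equation A B g₁ g₂ →
               (f : ProofNet ((A ⊸ B) ⊗ C) D) →
               EqualsDiagram _≈Σ_ f₁ (diagram f ∘ᵈ (⌜ diagram g₁ ⌝ᵈ ⊗ᵈ idᵈ) ∘ᵈ unitorᵈ) →
               EqualsDiagram _≈Σ_ f₂ (diagram f ∘ᵈ (⌜ diagram g₂ ⌝ᵈ ⊗ᵈ idᵈ) ∘ᵈ unitorᵈ) →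
               TheoryStep f₁ f₂

  infix 4 _≈_ _≈_∘_

  _≈_ : ∀ {A B} → ProofNet A B → ProofNet A B → Set
  _≈_ = EqClosure TheoryStep

  _≈_∘_ : ∀ {A B D} → ProofNet A B → ProofNet D B → ProofNet A D → Set
  f ≈ f₂ ∘ f₁ = EqualsDiagram _≈_ f (diagram f₂ ∘ᵈ diagram f₁)

{-# OPTIONS --safe #-}

-- Take D = (A_c ⊸ B_c) ⊗ … ⊗ A, with one factor for each cell c : A_c → B_c in C₁.  The net
-- f₁ is the identity of A tensored with the names of the operations in C₁, and f₂ is f with
-- each cell of C₁ absorbed into the domain: the ports of the cell become those of the factor
-- A_c ⊸ B_c, whose dual is the formula A_c ⊗ B_c^⊥ of the cell.  Since f₁ merely relays ports
-- through D, the composite has the very wires of f, and no equation or rewiring is needed.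
--
-- A switching of f₂ is a switching of f with the ⅋s joining the factors of D^⊥ added, each by
-- a bridge, so f₂ is correct.  A switching of f₁ arises from one of the identity linking of D
-- by contracting these ⅋s, and the identity linkings are correct because a switching of P^⊥
-- linked to one of P is assembled, by induction on P, from smaller trees joined by bridges.
module Submission where

open import Defs
open import Data.Bool using (Bool; true; false)
open import Data.Empty using (⊥-elim) renaming (⊥ to Empty)
open import Data.Fin using (Fin; zero; suc)
open import Data.Fin.Subset using (Subset; _∪_; _∩_; ⊤; ⊥; inside; outside; ∣_∣) renaming (_∈_ to _∈ˢ_)
open import Data.Fin.Subset.Properties using (∈⊤; ∉⊥; x∈p∪q⁻; x∈p∩q⁺)
open import Data.List using (map; []; _∷_)
open import Data.List.Membership.Propositional using (_∈_; _∉_)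
open import Data.List.Relation.Unary.All as All using (All; []; _∷_)
open import Data.List.Relation.Unary.AllPairs using (_∷_)
open import Data.List.Relation.Unary.Any using (here; there)
open import Data.List.Relation.Unary.Unique.Propositional using (Unique)
import Data.List.Relation.Unary.Unique.Propositional.Properties as Unique
open import Data.Maybe as Maybe using (just)
open import Data.Nat using (ℕ; zero; suc)
open import Data.Product as Product using (Σ-syntax; ∃; ∃-syntax; _×_; _,_; proj₁; proj₂; map₂; swap)
open import Data.Sign using (Sign; opposite) renaming (+ to ⁺; - to ⁻)
open import Data.Sum as Sum using (_⊎_; inj₁; inj₂; [_,_])
open import Data.Sum.Properties using (inj₁-injective; inj₂-injective)
open import Data.Unit using (tt) renaming (⊤ to Unit)
open import Data.Vec using ([]; _∷_; here; there)
open import Data.Vec.Properties.WithK using ([]=-irrelevant)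
open import Function using (id; case_of_) renaming (_∘_ to _⊚_)
open import Function.Bundles using (_↔_; mk↔ₛ′; mk⇔; Inverse)
open import Relation.Binary.Construct.Closure.ReflexiveTransitive using (ε)
open import Relation.Binary.PropositionalEquality
  using (_≡_; _≢_; refl; sym; trans; cong; cong₂; subst; subst₂)
open import Relation.Binary.PropositionalEquality.WithK using (≡-irrelevant)

-- Bridges and trees

open Graph using (Joins; Walk; []; step; edges; vertices; IsCycle; Acyclic; Connected)

-- The two factors call for different proofs of acyclicity. Of `f` only the absence of cycles is
-- given, so a cycle of `f₂` has to be lifted, edge by edge, to a cycle of `f`. The graph of an
-- identity linking is built explicitly, so there each edge can carry a Boolean labelling of the
-- vertices showing that it is a bridge; such labellings extend over joins and pull back along
-- morphisms without any walk being inspected. Connectivity travels the other way, along maps that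
-- may send an edge to a walk. The tensors of D are harmless on both sides. In the domain of `f₂`
-- they become ⅋s, and a switched ⅋ adds one node and one edge. In the codomain of `f₁` they remain
-- tensors and belong to a switching of the identity linking. The obstacle is the comparison of a
-- cell with its factor: the dual of `A_c ⊸ B_c` contains `dual (dual ⟦ A_c ⟧)` where the cell has
-- `⟦ A_c ⟧`. Ports, nodes, switchings and edges of the dual of D are therefore sorted into those of
-- A, of the cells and of the outer ⅋s by explicit bijections.

diagonal : ∀ {G : Graph} {u v} → u ≡ v → Walk G u v
diagonal refl = []

module _ {G : Graph} where
  open Graph G using (Vertex; Edge; ends)

  _▷_ : ∀ {u v w} → Walk G u v → Walk G v w → Walk G u w
  []         ▷ q = q
  step e j p ▷ q = step e j (p ▷ q)

  flip : ∀ {e u v} → Joins G e u v → Joins G e v u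
  flip = [ inj₂ , inj₁ ]

  joins-unique : ∀ {e u v x y} → Joins G e u v → Joins G e x y →
                 (u ≡ x × v ≡ y) ⊎ (v ≡ x × u ≡ y)
  joins-unique (inj₁ refl) (inj₁ refl) = inj₁ (refl , refl)
  joins-unique (inj₁ refl) (inj₂ refl) = inj₂ (refl , refl)
  joins-unique (inj₂ refl) (inj₁ refl) = inj₂ (refl , refl)
  joins-unique (inj₂ refl) (inj₂ refl) = inj₁ (refl , refl)

  reverse : ∀ {u v} → Walk G u v → Walk G v u
  reverse []           = []
  reverse (step e j p) = reverse p ▷ step e (flip {e = e} j) []

  along : ∀ e → Walk G (proj₁ (ends e)) (proj₂ (ends e))
  along e = step e (inj₁ refl) []

-- A certificate that e is a bridge: it is the only edge joining the two sides.
record Cut (G : Graph) (e : Graph.Edge G) : Set where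
  open Graph G using (Vertex; ends)
  field
    side      : Vertex → Bool
    separates : side (proj₁ (ends e)) ≢ side (proj₂ (ends e))
    preserves : ∀ e′ → e ≢ e′ → side (proj₁ (ends e′)) ≡ side (proj₂ (ends e′))

module _ {G : Graph} {e : Graph.Edge G} (k : Cut G e) where
  open Cut k

  preserves-joins : ∀ {e′ u v} → e ≢ e′ → Joins G e′ u v → side u ≡ side v
  preserves-joins ne (inj₁ eq) =
    subst (λ p → side (proj₁ p) ≡ side (proj₂ p)) eq (preserves _ ne)
  preserves-joins ne (inj₂ eq) =
    sym (subst (λ p → side (proj₁ p) ≡ side (proj₂ p)) eq (preserves _ ne))

  separates-joins : ∀ {u v} → Joins G e u v → side u ≢ side v
  separates-joins (inj₁ eq) = subst (λ p → side (proj₁ p) ≢ side (proj₂ p)) eq separates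
  separates-joins (inj₂ eq) =
    subst (λ p → side (proj₁ p) ≢ side (proj₂ p)) eq separates ⊚ sym

  avoiding⇒same-side : ∀ {u v} (w : Walk G u v) → All (e ≢_) (edges G w) → side u ≡ side v
  avoiding⇒same-side []           []       = refl
  avoiding⇒same-side (step _ j w) (n ∷ ns) =
    trans (preserves-joins n j) (avoiding⇒same-side w ns)

  -- A walk without repeated edges takes `e` once, and all its other steps keep the side.
  crossing⇒other-side : ∀ {u v} (w : Walk G u v) → Unique (edges G w) →
                        e ∈ edges G w → side u ≢ side v
  crossing⇒other-side (step _ j w) (n ∷ _) (here refl) eq =
    separates-joins j (trans eq (sym (avoiding⇒same-side w n)))
  crossing⇒other-side (step _ j w) (n ∷ ns) (there e∈) eq =
    crossing⇒other-side w ns e∈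
      (trans (sym (preserves-joins (λ e≡ → All.lookup n e∈ (sym e≡)) j)) eq)

  cut∉cycle : ∀ {v} (w : Walk G v v) → Unique (edges G w) → e ∉ edges G w
  cut∉cycle w u e∈ = crossing⇒other-side w u e∈ refl

-- A cut for every edge takes the place of acyclicity, since vertex labellings are easier to build
-- and to transfer than statements about all cycles.
record Tree (G : Graph) : Set where
  field
    cut       : ∀ e → Cut G e
    connected : Connected G

cuts⇒acyclic : ∀ {G} → (∀ e → Cut G e) → Acyclic G
cuts⇒acyclic cut []           (ne , _)    = ne refl
cuts⇒acyclic cut w@(step e _ _) (_ , u , _) = cut∉cycle (cut e) w u (here refl)

-- Edges are matched up to orientation: wires are directed by polarity, so some of them run against
-- the links of the identity graph onto which they are mapped.
record Hom (G H : Graph) : Set where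
  private
    module G = Graph G
    module H = Graph H
  field
    vertex    : G.Vertex → H.Vertex
    edge      : G.Edge → H.Edge
    joins  : ∀ e → H.Joins (edge e) (vertex (proj₁ (G.ends e))) (vertex (proj₂ (G.ends e)))

module _ {G H : Graph} where

  map-joins : (h : Hom G H) → ∀ {e u v} → Joins G e u v →
              Joins H (Hom.edge h e) (Hom.vertex h u) (Hom.vertex h v)
  map-joins h (inj₁ refl) = Hom.joins h _
  map-joins h (inj₂ refl) = flip {G = H} {e = Hom.edge h _} (Hom.joins h _)

  map-walk : (h : Hom G H) → ∀ {u v} → Walk G u v → Walk H (Hom.vertex h u) (Hom.vertex h v)
  map-walk h []           = []
  map-walk h (step e j w) = step (Hom.edge h e) (map-joins h j) (map-walk h w)

  -- The labelling composed with `h` could fail only at another edge with the same image as `e`,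
  -- which injectivity on edges excludes.
  pullback-cut : (h : Hom G H) → (∀ {e e′} → Hom.edge h e ≡ Hom.edge h e′ → e ≡ e′) →
                 ∀ {e} → Cut H (Hom.edge h e) → Cut G e
  pullback-cut h injective {e} k = record
    { side      = side ⊚ vertex
    ; separates = separates-joins k (joins e)
    ; preserves = λ e′ ne → preserves-joins k (ne ⊚ injective) (joins e′)
    }
    where open Hom h
          open Cut k

  -- An edge may go to a walk of any length, even the empty one, which covers contractions as well
  -- as embeddings.
  connected-along : (f : Graph.Vertex G → Graph.Vertex H) →
                    (∀ e → Walk H (f (proj₁ (Graph.ends G e))) (f (proj₂ (Graph.ends G e)))) →
                    (∀ v → ∃[ u ] Walk H v (f u)) → Connected G → Connected H
  connected-along f onEdge reach conn u v =
    proj₂ (reach u) ▷ (image (conn _ _) ▷ reverse (proj₂ (reach v)))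
    where
    onJoins : ∀ {e u v} → Joins G e u v → Walk H (f u) (f v)
    onJoins {e} (inj₁ refl) = onEdge e
    onJoins {e} (inj₂ refl) = reverse (onEdge e)

    image : ∀ {u v} → Walk G u v → Walk H (f u) (f v)
    image []           = []
    image (step e j w) = onJoins {e} j ▷ image w

  hom-edge-walk : (h : Hom G H) → let open Hom h in
                  ∀ e → Walk H (vertex (proj₁ (Graph.ends G e))) (vertex (proj₂ (Graph.ends G e)))
  hom-edge-walk h e = step (edge e) (joins e) []
    where open Hom h

  -- H is obtained from G by adding bridges.
  module _ (h : Hom G H) (injective : ∀ {u v} → Hom.vertex h u ≡ Hom.vertex h v → u ≡ v)
           (cut-or-image : ∀ e → Cut H e ⊎ ∃[ e′ ] Hom.edge h e′ ≡ e) where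
    open Hom h

    Image : Graph.Edge H → Set
    Image e = ∃[ e′ ] edge e′ ≡ e

    lift-joins : ∀ {e u y} → Joins H (edge e) (vertex u) y → ∃[ v ] vertex v ≡ y × Joins G e u v
    lift-joins {e} j with joins-unique {G = H} {e = edge e} (joins e) j
    ... | inj₁ (eq , eq′) with injective eq
    ... | refl = _ , eq′ , inj₁ refl
    lift-joins {e} j | inj₂ (eq , eq′) with injective eq
    ... | refl = _ , eq′ , inj₂ refl

    -- Both lists are compared because a cycle repeats neither edges nor vertices, and this freedom
    -- from repetition must descend to the lifted walk.
    Lift : ∀ {u y} → Walk H (vertex u) y → Set
    Lift {u} {y} w = ∃[ v ] Σ[ w′ ∈ Walk G u v ]
      (vertex v ≡ y × edges H w ≡ map edge (edges G w′) ×
       vertices H w ≡ map vertex (vertices G w′))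

    lift : ∀ {u y} (w : Walk H (vertex u) y) → All Image (edges H w) → Lift w
    lift []           []                = _ , [] , refl , refl , refl
    lift (step _ j w) ((e , refl) ∷ im) with lift-joins j
    ... | _ , refl , j′ with lift w im
    ... | _ , w′ , eqᵛ , eqs , eqs′ =
      _ , step e j′ w′ , eqᵛ , cong (edge e ∷_) eqs , cong (_ ∷_) eqs′

    origin : ∀ {e x y} → Joins H (edge e) x y → ∃[ u ] vertex u ≡ x
    origin {e} j with joins-unique {G = H} {e = edge e} (joins e) j
    ... | inj₁ (eq , _) = _ , eq
    ... | inj₂ (eq , _) = _ , eq

    images : ∀ {es} → (∀ {e} → e ∈ es → Cut H e → Empty) → All Image es
    images no = All.tabulate λ {e} e∈ → [ ⊥-elim ⊚ no e∈ , id ] (cut-or-image e)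

    -- A cycle traverses no cut, so all its edges are images and it lifts; injectivity on vertices
    -- closes the lifted walk.
    acyclic-along : Acyclic G → Acyclic H
    acyclic-along _ [] (ne , _) = ne refl
    acyclic-along acyclic w@(step _ _ _) (_ , ue , uv)
      with images {edges H w} (λ e∈ k → cut∉cycle k w ue e∈)
    acyclic-along acyclic w@(step _ j _) (_ , ue , uv) | im@((e , refl) ∷ _) with origin {e} j
    ... | u , refl with lift {u} w im
    ... | v , w′ , eqᵛ , eqs , eqs′ with injective eqᵛ
    ... | refl = acyclic w′
      ( (λ eq → case trans eqs (cong (map edge) eq) of λ ())
      , Unique.map⁻ (subst Unique eqs ue)
      , Unique.map⁻ (subst Unique eqs′ uv) )

record Retract (G H : Graph) : Set where
  field
    to          : Hom G H
    from        : Hom H G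
    vertex-from : ∀ v → Hom.vertex from (Hom.vertex to v) ≡ v
    edge-from   : ∀ e → Hom.edge from (Hom.edge to e) ≡ e

-- Cuts are pulled back along the injective `to`, connectivity is pushed forward along the
-- surjective `from`.
tree-retract : ∀ {G H} → Retract G H → Tree H → Tree G
tree-retract {G} r t = record
  { cut       = λ e → pullback-cut to
                  (λ {e} {e′} eq → trans (sym (edge-from e)) (trans (cong (Hom.edge from) eq) (edge-from e′)))
                  (cut (Hom.edge to e))
  ; connected = connected-along (Hom.vertex from) (hom-edge-walk from)
                  (λ v → _ , diagonal (sym (vertex-from v))) connected
  }
  where open Retract r
        open Tree t

data JoinEdge (E F : Set) : Set where
  left   : E → JoinEdge E F
  right  : F → JoinEdge E F
  bridge : JoinEdge E F

join : (G H : Graph) → Graph.Vertex G → Graph.Vertex H → Graph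
join G H u v = record
  { Vertex = Graph.Vertex G ⊎ Graph.Vertex H
  ; Edge   = JoinEdge (Graph.Edge G) (Graph.Edge H)
  ; ends   = λ where
      (left e)  → Product.map inj₁ inj₁ (Graph.ends G e)
      (right e) → Product.map inj₂ inj₂ (Graph.ends H e)
      bridge    → inj₁ u , inj₂ v
  }

-- A cut of one summand extends by giving the whole other summand the label of the near end of the
-- bridge. The bridge is cut by telling the summands apart.
tree-join : ∀ {G H u v} → Tree G → Tree H → Tree (join G H u v)
tree-join {G} {H} {u} {v} t t′ = record
  { cut = λ where
      (left e)  → let open Cut (Tree.cut t e) in record
        { side      = [ side , (λ _ → side u) ]
        ; separates = separates
        ; preserves = λ where
            (left e′) ne → preserves e′ (ne ⊚ cong left)
            (right _) _  → refl
            bridge    _  → refl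
        }
      (right e) → let open Cut (Tree.cut t′ e) in record
        { side      = [ (λ _ → side v) , side ]
        ; separates = separates
        ; preserves = λ where
            (left _)   _  → refl
            (right e′) ne → preserves e′ (ne ⊚ cong right)
            bridge     _  → refl
        }
      bridge    → record
        { side      = [ (λ _ → true) , (λ _ → false) ]
        ; separates = λ ()
        ; preserves = λ where
            (left _)  _  → refl
            (right _) _  → refl
            bridge    ne → ⊥-elim (ne refl)
        }
  ; connected = λ x y → toBridge x ▷ reverse (toBridge y)
  }
  where
  J : Graph
  J = join G H u v

  inˡ : Hom G J
  inˡ = record { vertex = inj₁ ; edge = left ; joins = λ _ → inj₁ refl }

  inʳ : Hom H J
  inʳ = record { vertex = inj₂ ; edge = right ; joins = λ _ → inj₁ refl }

  toBridge : ∀ x → Walk J x (inj₁ u)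
  toBridge (inj₁ x) = map-walk inˡ (Tree.connected t x u)
  toBridge (inj₂ x) = map-walk inʳ (Tree.connected t′ x v) ▷ reverse (along bridge)

point : Graph
point = record { Vertex = Unit ; Edge = Empty ; ends = λ () }

tree-point : Tree point
tree-point = record { cut = λ () ; connected = λ _ _ → [] }

-- Identity linkings

data LinkedEdge (E F L : Set) : Set where
  first  : E → LinkedEdge E F L
  second : F → LinkedEdge E F L
  link   : L → LinkedEdge E F L

module _ {X : Set} where

  linked : {P Q : Classical X} (σ : Switching P) (τ : Switching Q) {L : Set} →
           (L → Node P × Node Q) → Graph
  linked {P} {Q} σ τ {L} l = record
    { Vertex = Node P ⊎ Node Q
    ; Edge   = LinkedEdge (TreeEdge σ) (TreeEdge τ) L
    ; ends   = λ where
        (first e)  → inj₁ (parent e) , inj₁ (child e)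
        (second e) → inj₂ (parent e) , inj₂ (child e)
        (link x)   → Product.map inj₁ inj₂ (l x)
    }

  module _ {P Q : Classical X} {σ : Switching P} {τ : Switching Q} {L : Set} where

    linked-swap : {l : L → Node P × Node Q} {l′ : L → Node Q × Node P} →
                  (∀ x → l′ x ≡ swap (l x)) → Hom (linked σ τ l) (linked τ σ l′)
    linked-swap eq = record
      { vertex = λ { (inj₁ n) → inj₂ n ; (inj₂ n) → inj₁ n }
      ; edge   = λ { (first e) → second e ; (second e) → first e ; (link x) → link x }
      ; joins  = λ where
          (first e)  → inj₁ refl
          (second e) → inj₁ refl
          (link x)   → inj₂ (cong (Product.map inj₁ inj₂) (eq x))
      }

  -- Only a tensor on the first side facing a ⅋ on the second is assembled below; swapping reduces
  -- the opposite arrangement to it.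
  tree-swap : ∀ {P Q : Classical X} {σ : Switching P} {τ : Switching Q} {L : Set}
              {l : L → Node P × Node Q} {l′ : L → Node Q × Node P} →
              (∀ x → l′ x ≡ swap (l x)) → Tree (linked σ τ l) → Tree (linked τ σ l′)
  tree-swap {l = l} {l′} eq = tree-retract record
    { to          = linked-swap (λ x → sym (cong swap (eq x)))
    ; from        = linked-swap eq
    ; vertex-from = λ { (inj₁ _) → refl ; (inj₂ _) → refl }
    ; edge-from   = λ { (first _) → refl ; (second _) → refl ; (link _) → refl }
    }

  module _ {P Q P′ Q′ : Classical X} {c c′ : Connective} {L L′ : Set} where

    sumLink : (L → Node P × Node P′) → (L′ → Node Q × Node Q′) →
              L ⊎ L′ → Node (P ⟨ c ⟩ Q) × Node (P′ ⟨ c′ ⟩ Q′)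
    sumLink l l′ (inj₁ x) = Product.map left left (l x)
    sumLink l l′ (inj₂ x) = Product.map right right (l′ x)

  module _ {P Q P′ Q′ : Classical X} {σ : Switching P} {τ : Switching Q}
           {σ′ : Switching P′} {τ′ : Switching Q′} {L L′ : Set}
           (l : L → Node P × Node P′) (l′ : L′ → Node Q × Node Q′) (s : Side) where

    private
      -- The root of the tensor is a point with a bridge to each smaller tree. In `J` the root of
      -- the ⅋ then hangs as a leaf on the argument that `s` keeps.
      K : Graph
      K = join (join point (linked σ σ′ l) tt (inj₁ root)) (linked τ τ′ l′)
               (inj₁ tt) (inj₁ root)

      kept : Side → Graph.Vertex K
      kept leftSide  = inj₁ (inj₂ (inj₂ root))
      kept rightSide = inj₂ (inj₂ root)

      J : Graph
      J = join point K tt (kept s)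

      G : Graph
      G = linked (choose both σ τ) (choose (only s) σ′ τ′) (sumLink l l′)

      to : Hom G J
      to = record
        { vertex = λ where
            (inj₁ root)      → inj₂ (inj₁ (inj₁ tt))
            (inj₁ (left n))  → inj₂ (inj₁ (inj₂ (inj₁ n)))
            (inj₁ (right n)) → inj₂ (inj₂ (inj₁ n))
            (inj₂ root)      → inj₁ tt
            (inj₂ (left n))  → inj₂ (inj₁ (inj₂ (inj₂ n)))
            (inj₂ (right n)) → inj₂ (inj₂ (inj₂ n))
        ; edge = λ where
            (first (here leftSide both))  → right (left bridge)
            (first (here rightSide both)) → right bridge
            (first (left e))              → right (left (right (first e)))
            (first (right e))             → right (right (first e))
            (second (here _ only))        → bridge
            (second (left e))             → right (left (right (second e)))
            (second (right e))            → right (right (second e))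
            (link (inj₁ x))               → right (left (right (link x)))
            (link (inj₂ x))               → right (right (link x))
        ; joins = λ where
            (first (here leftSide both))   → inj₁ refl
            (first (here rightSide both))  → inj₁ refl
            (first (left e))               → inj₁ refl
            (first (right e))              → inj₁ refl
            (second (here leftSide only))  → inj₁ refl
            (second (here rightSide only)) → inj₁ refl
            (second (left e))              → inj₁ refl
            (second (right e))             → inj₁ refl
            (link (inj₁ x))                → inj₁ refl
            (link (inj₂ x))                → inj₁ refl
        }

      vertexFrom : Graph.Vertex J → Graph.Vertex G
      vertexFrom (inj₁ tt)                    = inj₂ root
      vertexFrom (inj₂ (inj₁ (inj₁ tt)))        = inj₁ root
      vertexFrom (inj₂ (inj₁ (inj₂ (inj₁ n)))) = inj₁ (left n)
      vertexFrom (inj₂ (inj₁ (inj₂ (inj₂ n)))) = inj₂ (left n)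
      vertexFrom (inj₂ (inj₂ (inj₁ n)))        = inj₁ (right n)
      vertexFrom (inj₂ (inj₂ (inj₂ n)))        = inj₂ (right n)

      bridgeJoins : ∀ s → _≡_ {A = Graph.Vertex G}
                            (inj₂ (child (here {k = only s} {σ′} {τ′} s only)))
                            (vertexFrom (inj₂ (kept s)))
      bridgeJoins leftSide  = refl
      bridgeJoins rightSide = refl

      from : Hom J G
      from = record
        { vertex = vertexFrom
        ; edge = λ where
            bridge                          → second (here s only)
            (right bridge)                  → first (here rightSide both)
            (right (left bridge))           → first (here leftSide both)
            (right (left (right (first e)))) → first (left e)
            (right (left (right (second e)))) → second (left e)
            (right (left (right (link x)))) → link (inj₁ x)
            (right (right (first e)))       → first (right e)
            (right (right (second e)))      → second (right e)
            (right (right (link x)))        → link (inj₂ x)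
        ; joins = λ where
            bridge                            → inj₁ (cong (inj₂ root ,_) (bridgeJoins s))
            (right bridge)                    → inj₁ refl
            (right (left bridge))             → inj₁ refl
            (right (left (right (first e))))  → inj₁ refl
            (right (left (right (second e)))) → inj₁ refl
            (right (left (right (link x))))   → inj₁ refl
            (right (right (first e)))         → inj₁ refl
            (right (right (second e)))        → inj₁ refl
            (right (right (link x)))          → inj₁ refl
        }

    tree-sumLink : Tree (linked σ σ′ l) → Tree (linked τ τ′ l′) → Tree G
    tree-sumLink t t′ =
      tree-retract retract (tree-join tree-point (tree-join (tree-join tree-point t) t′))
      where
      retract : Retract G J
      retract = record
        { to          = to
        ; from        = from
        ; vertex-from = λ where
            (inj₁ root)      → refl
            (inj₁ (left n))  → refl
            (inj₁ (right n)) → refl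
            (inj₂ root)      → refl
            (inj₂ (left n))  → refl
            (inj₂ (right n)) → refl
        ; edge-from = λ where
            (first (here leftSide both))  → refl
            (first (here rightSide both)) → refl
            (first (left e))              → refl
            (first (right e))             → refl
            (second (here _ only))        → refl
            (second (left e))             → refl
            (second (right e))            → refl
            (link (inj₁ x))               → refl
            (link (inj₂ x))               → refl
        }

  tree-literals : ∀ {s s′ t t′} →
                  Tree (linked {lit s t} {lit s′ t′} lit lit {Unit} (λ _ → root , root))
  tree-literals = tree-retract record
    { to = record
      { vertex = λ { (inj₁ root) → inj₁ tt ; (inj₂ root) → inj₂ tt }
      ; edge   = λ { (link tt) → bridge }
      ; joins  = λ { (link tt) → inj₁ refl } }
    ; from = record
      { vertex = λ { (inj₁ tt) → inj₁ root ; (inj₂ tt) → inj₂ root }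
      ; edge   = λ { bridge → link tt ; (left ()) ; (right ()) }
      ; joins  = λ { bridge → inj₁ refl ; (left ()) ; (right ()) } }
    ; vertex-from = λ { (inj₁ root) → refl ; (inj₂ root) → refl }
    ; edge-from   = λ { (link tt) → refl }
    } (tree-join tree-point tree-point)

  Leaf : Classical X → Set
  Leaf (lit _ _)   = Unit
  Leaf (P ⟨ _ ⟩ Q) = Leaf P ⊎ Leaf Q

  -- These are the wires of the identity linking of P without their direction and atom, which an
  -- undirected switching graph does not see.
  dualLink : ∀ P → Leaf P → Node (dual P) × Node P
  dualLink (lit _ _)   = λ _ → root , root
  dualLink (P ⟨ c ⟩ Q) = sumLink (dualLink P) (dualLink Q)

  swap-sumLink : ∀ {P Q P′ Q′ : Classical X} {c c′ : Connective} {L L′ : Set}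
                 (l : L → Node P × Node P′) (l′ : L′ → Node Q × Node Q′) x →
                 swap (sumLink {c = c} {c′} l l′ x) ≡
                 sumLink {c = c′} {c} (λ y → swap (l y)) (λ y → swap (l′ y)) x
  swap-sumLink l l′ (inj₁ x) = refl
  swap-sumLink l l′ (inj₂ x) = refl

  -- Of two dual connectives facing each other exactly one is a tensor. It alone connects the trees
  -- of the two arguments: a second connection would close a cycle, and with none the graph would
  -- fall apart.
  tree-dualLink : ∀ P (σ : Switching (dual P)) (τ : Switching P) → Tree (linked σ τ (dualLink P))
  tree-dualLink (lit _ _) lit lit = tree-literals
  tree-dualLink (P ⟨ tensor ⟩ Q) (choose (only s) σ σ′) (choose both τ τ′) =
    tree-swap (λ x → sym (swap-sumLink (λ y → swap (dualLink P y)) (λ y → swap (dualLink Q y)) x))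
      (tree-sumLink _ _ s (tree-swap (λ _ → refl) (tree-dualLink P σ τ))
                          (tree-swap (λ _ → refl) (tree-dualLink Q σ′ τ′)))
  tree-dualLink (P ⟨ par ⟩ Q) (choose both σ σ′) (choose (only s) τ τ′) =
    tree-sumLink (dualLink P) (dualLink Q) s (tree-dualLink P σ τ) (tree-dualLink Q σ′ τ′)

-- Double duals and double opposites

module _ {X : Set} where

  undualNode : (P : Classical X) → Node (dual P) → Node P
  undualNode (lit _ _)   root      = root
  undualNode (P ⟨ _ ⟩ Q) root      = root
  undualNode (P ⟨ _ ⟩ Q) (left n)  = left (undualNode P n)
  undualNode (P ⟨ _ ⟩ Q) (right n) = right (undualNode Q n)

  undualNode-dualNode : {P : Classical X} (n : Node P) → undualNode P (dualNode n) ≡ n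
  undualNode-dualNode {lit _ _}   root      = refl
  undualNode-dualNode {P ⟨ _ ⟩ Q} root      = refl
  undualNode-dualNode {P ⟨ _ ⟩ Q} (left n)  = cong left (undualNode-dualNode n)
  undualNode-dualNode {P ⟨ _ ⟩ Q} (right n) = cong right (undualNode-dualNode n)

  dualNode-undualNode : (P : Classical X) (n : Node (dual P)) → dualNode (undualNode P n) ≡ n
  dualNode-undualNode (lit _ _)   root      = refl
  dualNode-undualNode (P ⟨ _ ⟩ Q) root      = refl
  dualNode-undualNode (P ⟨ _ ⟩ Q) (left n)  = cong left (dualNode-undualNode P n)
  dualNode-undualNode (P ⟨ _ ⟩ Q) (right n) = cong right (dualNode-undualNode Q n)

  -- This map carries a switching of the source of a cell to the doubly dual copy of that formula in
  -- the domain, so that nothing is transported along an equation between formulae. The clauses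
  -- split on the choice because `dualᶜ (dualᶜ c)` reduces only at a known connective.
  double : {P : Classical X} → Switching P → Switching (dual (dual P))
  double lit                     = lit
  double (choose both σ τ)       = choose both (double σ) (double τ)
  double (choose (only s) σ τ)   = choose (only s) (double σ) (double τ)

  double-surjective : (P : Classical X) (τ : Switching (dual (dual P))) → ∃[ σ ] double σ ≡ τ
  double-surjective (lit _ _) lit = lit , refl
  double-surjective (P ⟨ tensor ⟩ Q) (choose both σ τ)
    with double-surjective P σ | double-surjective Q τ
  ... | _ , refl | _ , refl = choose both _ _ , refl
  double-surjective (P ⟨ par ⟩ Q) (choose (only s) σ τ)
    with double-surjective P σ | double-surjective Q τ
  ... | _ , refl | _ , refl = choose (only s) _ _ , refl

  doubleEdge : {P : Classical X} (σ : Switching P) → TreeEdge σ → TreeEdge (double σ)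
  doubleEdge (choose both σ τ)     (here i both) = here i both
  doubleEdge (choose (only s) σ τ) (here i only) = here i only
  doubleEdge (choose both σ τ)     (left e)      = left (doubleEdge σ e)
  doubleEdge (choose (only s) σ τ) (left e)      = left (doubleEdge σ e)
  doubleEdge (choose both σ τ)     (right e)     = right (doubleEdge τ e)
  doubleEdge (choose (only s) σ τ) (right e)     = right (doubleEdge τ e)

  undoubleEdge : {P : Classical X} (σ : Switching P) → TreeEdge (double σ) → TreeEdge σ
  undoubleEdge (choose both σ τ)     (here i both) = here i both
  undoubleEdge (choose (only s) σ τ) (here i only) = here i only
  undoubleEdge (choose both σ τ)     (left e)      = left (undoubleEdge σ e)
  undoubleEdge (choose (only s) σ τ) (left e)      = left (undoubleEdge σ e)
  undoubleEdge (choose both σ τ)     (right e)     = right (undoubleEdge τ e)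
  undoubleEdge (choose (only s) σ τ) (right e)     = right (undoubleEdge τ e)

  undoubleEdge-doubleEdge : {P : Classical X} (σ : Switching P) (e : TreeEdge σ) →
                            undoubleEdge σ (doubleEdge σ e) ≡ e
  undoubleEdge-doubleEdge (choose both σ τ)     (here i both) = refl
  undoubleEdge-doubleEdge (choose (only s) σ τ) (here i only) = refl
  undoubleEdge-doubleEdge (choose both σ τ)     (left e)      = cong left (undoubleEdge-doubleEdge σ e)
  undoubleEdge-doubleEdge (choose (only s) σ τ) (left e)      = cong left (undoubleEdge-doubleEdge σ e)
  undoubleEdge-doubleEdge (choose both σ τ)     (right e)     = cong right (undoubleEdge-doubleEdge τ e)
  undoubleEdge-doubleEdge (choose (only s) σ τ) (right e)     = cong right (undoubleEdge-doubleEdge τ e)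

  doubleEdge-undoubleEdge : {P : Classical X} (σ : Switching P) (e : TreeEdge (double σ)) →
                            doubleEdge σ (undoubleEdge σ e) ≡ e
  doubleEdge-undoubleEdge (choose both σ τ)     (here i both) = refl
  doubleEdge-undoubleEdge (choose (only s) σ τ) (here i only) = refl
  doubleEdge-undoubleEdge (choose both σ τ)     (left e)      = cong left (doubleEdge-undoubleEdge σ e)
  doubleEdge-undoubleEdge (choose (only s) σ τ) (left e)      = cong left (doubleEdge-undoubleEdge σ e)
  doubleEdge-undoubleEdge (choose both σ τ)     (right e)     = cong right (doubleEdge-undoubleEdge τ e)
  doubleEdge-undoubleEdge (choose (only s) σ τ) (right e)     = cong right (doubleEdge-undoubleEdge τ e)

  ends-doubleEdge : {P : Classical X} (σ : Switching P) (e : TreeEdge σ) →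
                    parent (doubleEdge σ e) ≡ dualNode (dualNode (parent e)) ×
                    child (doubleEdge σ e) ≡ dualNode (dualNode (child e))
  ends-doubleEdge (choose both σ τ)     (here leftSide both)  = refl , refl
  ends-doubleEdge (choose both σ τ)     (here rightSide both) = refl , refl
  ends-doubleEdge (choose (only s) σ τ) (here leftSide only)  = refl , refl
  ends-doubleEdge (choose (only s) σ τ) (here rightSide only) = refl , refl
  ends-doubleEdge (choose both σ τ)     (left e)  =
    Product.map (cong left) (cong left) (ends-doubleEdge σ e)
  ends-doubleEdge (choose (only s) σ τ) (left e)  =
    Product.map (cong left) (cong left) (ends-doubleEdge σ e)
  ends-doubleEdge (choose both σ τ)     (right e) =
    Product.map (cong right) (cong right) (ends-doubleEdge τ e)
  ends-doubleEdge (choose (only s) σ τ) (right e) =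
    Product.map (cong right) (cong right) (ends-doubleEdge τ e)

  -- opposite is an involution only up to a case distinction on the sign.
  opp² : ∀ {A : Formula X} s {t} → Port A s t → Port A (opposite (opposite s)) t
  opp² ⁺ p = p
  opp² ⁻ p = p

  unopp² : ∀ {A : Formula X} s {t} → Port A (opposite (opposite s)) t → Port A s t
  unopp² ⁺ p = p
  unopp² ⁻ p = p

  unopp²-opp² : ∀ {A : Formula X} s {t} (p : Port A s t) → unopp² s (opp² s p) ≡ p
  unopp²-opp² ⁺ p = refl
  unopp²-opp² ⁻ p = refl

  opp²-unopp² : ∀ {A : Formula X} s {t} (p : Port A (opposite (opposite s)) t) →
                opp² s (unopp² s p) ≡ p
  opp²-unopp² ⁺ p = refl
  opp²-unopp² ⁻ p = refl

  leaf-opp² : ∀ {A : Formula X} s {t} (p : Port A s t) → leaf (opp² s p) ≡ leaf p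
  leaf-opp² ⁺ p = refl
  leaf-opp² ⁻ p = refl

-- Formulae absorbing cells

module Absorption (S : Signature) (A : Formula (Signature.Sort S)) where
  open Signature S
  open Operation

  private
    variable
      m : ℕ
      s : Sign
      t : Atom Sort

  Labels : ℕ → Set
  Labels m = Fin m → Operation S

  cellFormula : Operation S → Classical Sort
  cellFormula o = ⟦ source o ⟧ ⟨ tensor ⟩ dual ⟦ target o ⟧

  -- Since the tensor ends in `A` rather than in `I`, every port is a copy of a port of `A` or of a
  -- cell; an additional unit would need a wire of its own.
  absorb : ∀ m → Labels m → Formula Sort
  absorb zero    ℓ = A
  absorb (suc m) ℓ = (source (ℓ zero) ⊸ target (ℓ zero)) ⊗ absorb m (ℓ ⊚ suc)

  -- The sign is the global polarity in a linking with domain `A` and these cells. A port keeps it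
  -- when its cell moves into the domain, whence the `opposite` in the type of `port`.
  data Part (ℓ : Labels m) (s : Sign) (t : Atom Sort) : Set where
    base : Port A (opposite s) t → Part ℓ s t
    arg  : ∀ i → Port (source (ℓ i)) s t → Part ℓ s t
    res  : ∀ i → Port (target (ℓ i)) (opposite s) t → Part ℓ s t

  later : {ℓ : Labels (suc m)} → Part (ℓ ⊚ suc) s t → Part ℓ s t
  later (base p)  = base p
  later (arg i p) = arg (suc i) p
  later (res i p) = res (suc i) p

  port : (ℓ : Labels m) → Part ℓ s t → Port (absorb m ℓ) (opposite s) t
  port {zero}      ℓ (base p)        = p
  port {suc m}     ℓ (base p)        = ⊗ʳ (port (ℓ ⊚ suc) (base p))
  port {s = s}     ℓ (arg zero p)    = ⊗ˡ (⊸ˡ (opp² s p))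
  port             ℓ (arg (suc i) p) = ⊗ʳ (port (ℓ ⊚ suc) (arg i p))
  port             ℓ (res zero p)    = ⊗ˡ (⊸ʳ p)
  port             ℓ (res (suc i) p) = ⊗ʳ (port (ℓ ⊚ suc) (res i p))

  part : (ℓ : Labels m) → Port (absorb m ℓ) (opposite s) t → Part ℓ s t
  part {zero}          ℓ p           = base p
  part {suc m} {s = s} ℓ (⊗ˡ (⊸ˡ p)) = arg zero (unopp² s p)
  part {suc m}         ℓ (⊗ˡ (⊸ʳ p)) = res zero p
  part {suc m}         ℓ (⊗ʳ p)      = later (part (ℓ ⊚ suc) p)

  port-later : (ℓ : Labels (suc m)) (x : Part (ℓ ⊚ suc) s t) →
               port ℓ (later x) ≡ ⊗ʳ (port (ℓ ⊚ suc) x)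
  port-later ℓ (base p)  = refl
  port-later ℓ (arg i p) = refl
  port-later ℓ (res i p) = refl

  part-port : (ℓ : Labels m) (x : Part ℓ s t) → part ℓ (port ℓ x) ≡ x
  part-port {zero}  ℓ (base p)        = refl
  part-port {suc m} ℓ (base p)        = cong later (part-port (ℓ ⊚ suc) (base p))
  part-port {s = s} ℓ (arg zero p)    = cong (arg zero) (unopp²-opp² s p)
  part-port         ℓ (arg (suc i) p) = cong later (part-port (ℓ ⊚ suc) (arg i p))
  part-port         ℓ (res zero p)    = refl
  part-port         ℓ (res (suc i) p) = cong later (part-port (ℓ ⊚ suc) (res i p))

  port-part : (ℓ : Labels m) (p : Port (absorb m ℓ) (opposite s) t) → port ℓ (part ℓ p) ≡ p
  port-part {zero}          ℓ p           = refl
  port-part {suc m} {s = s} ℓ (⊗ˡ (⊸ˡ p)) = cong (⊗ˡ ⊚ ⊸ˡ) (opp²-unopp² s p)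
  port-part {suc m}         ℓ (⊗ˡ (⊸ʳ p)) = refl
  port-part {suc m}         ℓ (⊗ʳ p)      =
    trans (port-later ℓ (part (ℓ ⊚ suc) p)) (cong ⊗ʳ (port-part (ℓ ⊚ suc) p))

  -- The nodes of dual ⟦ absorb m ℓ ⟧ other than the m roots of its outer ⅋s.
  data CoreNode (ℓ : Labels m) : Set where
    base : Node (dual ⟦ A ⟧) → CoreNode ℓ
    cell : ∀ i → Node (cellFormula (ℓ i)) → CoreNode ℓ

  laterNode : {ℓ : Labels (suc m)} → CoreNode (ℓ ⊚ suc) → CoreNode ℓ
  laterNode (base n)   = base n
  laterNode (cell i n) = cell (suc i) n

  cellNode : ∀ o → Node (cellFormula o) → Node (dual ⟦ source o ⊸ target o ⟧)
  cellNode o root      = root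
  cellNode o (left n)  = left (dualNode (dualNode n))
  cellNode o (right n) = right n

  uncellNode : ∀ o → Node (dual ⟦ source o ⊸ target o ⟧) → Node (cellFormula o)
  uncellNode o root      = root
  uncellNode o (left n)  = left (undualNode ⟦ source o ⟧ (undualNode _ n))
  uncellNode o (right n) = right n

  uncellNode-cellNode : ∀ o n → uncellNode o (cellNode o n) ≡ n
  uncellNode-cellNode o root      = refl
  uncellNode-cellNode o (left n)  =
    cong left (trans (cong (undualNode ⟦ source o ⟧) (undualNode-dualNode (dualNode n)))
                     (undualNode-dualNode n))
  uncellNode-cellNode o (right n) = refl

  cellNode-uncellNode : ∀ o n → cellNode o (uncellNode o n) ≡ n
  cellNode-uncellNode o root      = refl
  cellNode-uncellNode o (left n)  =
    cong left (trans (cong dualNode (dualNode-undualNode ⟦ source o ⟧ (undualNode _ n)))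
                     (dualNode-undualNode (dual ⟦ source o ⟧) n))
  cellNode-uncellNode o (right n) = refl

  core : (ℓ : Labels m) → CoreNode ℓ → Node (dual ⟦ absorb m ℓ ⟧)
  core {zero}  ℓ (base n)         = n
  core {suc m} ℓ (base n)         = right (core (ℓ ⊚ suc) (base n))
  core         ℓ (cell zero n)    = left (cellNode (ℓ zero) n)
  core         ℓ (cell (suc i) n) = right (core (ℓ ⊚ suc) (cell i n))

  outerNode : (ℓ : Labels m) → Fin m → Node (dual ⟦ absorb m ℓ ⟧)
  outerNode ℓ zero    = root
  outerNode ℓ (suc i) = right (outerNode (ℓ ⊚ suc) i)

  classify : (ℓ : Labels m) → Node (dual ⟦ absorb m ℓ ⟧) → CoreNode ℓ ⊎ Fin m
  classify {zero}  ℓ n         = inj₁ (base n)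
  classify {suc m} ℓ root      = inj₂ zero
  classify {suc m} ℓ (left n)  = inj₁ (cell zero (uncellNode (ℓ zero) n))
  classify {suc m} ℓ (right n) = Sum.map laterNode suc (classify (ℓ ⊚ suc) n)

  classify-core : (ℓ : Labels m) (x : CoreNode ℓ) → classify ℓ (core ℓ x) ≡ inj₁ x
  classify-core {zero}  ℓ (base n)         = refl
  classify-core {suc m} ℓ (base n)         =
    cong (Sum.map laterNode suc) (classify-core (ℓ ⊚ suc) (base n))
  classify-core         ℓ (cell zero n)    =
    cong (inj₁ ⊚ cell zero) (uncellNode-cellNode (ℓ zero) n)
  classify-core         ℓ (cell (suc i) n) =
    cong (Sum.map laterNode suc) (classify-core (ℓ ⊚ suc) (cell i n))

  classify-outer : (ℓ : Labels m) (i : Fin m) → classify ℓ (outerNode ℓ i) ≡ inj₂ i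
  classify-outer ℓ zero    = refl
  classify-outer ℓ (suc i) = cong (Sum.map laterNode suc) (classify-outer (ℓ ⊚ suc) i)

  core-later : (ℓ : Labels (suc m)) (x : CoreNode (ℓ ⊚ suc)) →
               core ℓ (laterNode x) ≡ right (core (ℓ ⊚ suc) x)
  core-later ℓ (base n)   = refl
  core-later ℓ (cell i n) = refl

  unclassify : (ℓ : Labels m) (n : Node (dual ⟦ absorb m ℓ ⟧)) →
               [ core ℓ , outerNode ℓ ] (classify ℓ n) ≡ n
  unclassify {zero}  ℓ n         = refl
  unclassify {suc m} ℓ root      = refl
  unclassify {suc m} ℓ (left n)  = cong left (cellNode-uncellNode (ℓ zero) n)
  unclassify {suc m} ℓ (right n) with classify (ℓ ⊚ suc) n | unclassify (ℓ ⊚ suc) n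
  ... | inj₁ x | eq = trans (core-later ℓ x) (cong right eq)
  ... | inj₂ i | eq = cong right eq

  leafNode : (ℓ : Labels m) → Part ℓ s t → CoreNode ℓ
  leafNode ℓ (base p)  = base (dualNode (leaf p))
  leafNode ℓ (arg i p) = cell i (left (leaf p))
  leafNode ℓ (res i p) = cell i (right (dualNode (leaf p)))

  leaf-port : (ℓ : Labels m) (x : Part ℓ s t) →
              dualNode (leaf (port ℓ x)) ≡ core ℓ (leafNode ℓ x)
  leaf-port {zero}  ℓ (base p)        = refl
  leaf-port {suc m} ℓ (base p)        = cong right (leaf-port (ℓ ⊚ suc) (base p))
  leaf-port {s = s} ℓ (arg zero p)    = cong (λ n → left (cellNode (ℓ zero) (left n))) (leaf-opp² s p)
  leaf-port         ℓ (arg (suc i) p) = cong right (leaf-port (ℓ ⊚ suc) (arg i p))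
  leaf-port         ℓ (res zero p)    = refl
  leaf-port         ℓ (res (suc i) p) = cong right (leaf-port (ℓ ⊚ suc) (res i p))

  CellSwitchings : Labels m → Set
  CellSwitchings ℓ = ∀ i → Switching (cellFormula (ℓ i))

  cellSwitching : ∀ o → Switching (cellFormula o) → Switching (dual ⟦ source o ⊸ target o ⟧)
  cellSwitching o (choose both σ τ) = choose both (double σ) τ

  -- The function `κ` names the argument kept by each outer ⅋, the only freedom that a switching of
  -- this dual has beyond switchings of `A` and of the cells.
  assemble : (ℓ : Labels m) → Switching (dual ⟦ A ⟧) → CellSwitchings ℓ → (Fin m → Side) →
             Switching (dual ⟦ absorb m ℓ ⟧)
  assemble {zero}  ℓ σ ζ κ = σ
  assemble {suc m} ℓ σ ζ κ =
    choose (only (κ zero)) (cellSwitching (ℓ zero) (ζ zero)) (assemble (ℓ ⊚ suc) σ (ζ ⊚ suc) (κ ⊚ suc))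

  assemble-surjective : (ℓ : Labels m) (τ : Switching (dual ⟦ absorb m ℓ ⟧)) →
                        ∃[ σ ] Σ[ ζ ∈ CellSwitchings ℓ ] ∃[ κ ] assemble ℓ σ ζ κ ≡ τ
  assemble-surjective {zero}  ℓ τ = τ , (λ ()) , (λ ()) , refl
  assemble-surjective {suc m} ℓ (choose (only k) (choose both τ₁ τ₂) τ)
    with double-surjective ⟦ source (ℓ zero) ⟧ τ₁ | assemble-surjective (ℓ ⊚ suc) τ
  ... | σ₁ , refl | σ , ζ , κ , refl =
    σ , (λ { zero → choose both σ₁ τ₂ ; (suc i) → ζ i }) , (λ { zero → k ; (suc i) → κ i }) , refl

  data PartEdge (ℓ : Labels m) (σ : Switching (dual ⟦ A ⟧)) (ζ : CellSwitchings ℓ) : Set where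
    base  : TreeEdge σ → PartEdge ℓ σ ζ
    cell  : ∀ i → TreeEdge (ζ i) → PartEdge ℓ σ ζ
    outer : Fin m → PartEdge ℓ σ ζ

  laterEdge : {ℓ : Labels (suc m)} {σ : Switching (dual ⟦ A ⟧)} {ζ : CellSwitchings ℓ} →
              PartEdge (ℓ ⊚ suc) σ (ζ ⊚ suc) → PartEdge ℓ σ ζ
  laterEdge (base e)   = base e
  laterEdge (cell i e) = cell (suc i) e
  laterEdge (outer i)  = outer (suc i)

  cellEdge : ∀ o (σ : Switching (cellFormula o)) → TreeEdge σ → TreeEdge (cellSwitching o σ)
  cellEdge o (choose both σ τ) (here i k) = here i k
  cellEdge o (choose both σ τ) (left e)   = left (doubleEdge σ e)
  cellEdge o (choose both σ τ) (right e)  = right e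

  uncellEdge : ∀ o (σ : Switching (cellFormula o)) → TreeEdge (cellSwitching o σ) → TreeEdge σ
  uncellEdge o (choose both σ τ) (here i k) = here i k
  uncellEdge o (choose both σ τ) (left e)   = left (undoubleEdge σ e)
  uncellEdge o (choose both σ τ) (right e)  = right e

  uncellEdge-cellEdge : ∀ o (σ : Switching (cellFormula o)) e →
                        uncellEdge o σ (cellEdge o σ e) ≡ e
  uncellEdge-cellEdge o (choose both σ τ) (here i k) = refl
  uncellEdge-cellEdge o (choose both σ τ) (left e)   = cong left (undoubleEdge-doubleEdge σ e)
  uncellEdge-cellEdge o (choose both σ τ) (right e)  = refl

  cellEdge-uncellEdge : ∀ o (σ : Switching (cellFormula o)) e →
                        cellEdge o σ (uncellEdge o σ e) ≡ e
  cellEdge-uncellEdge o (choose both σ τ) (here i k) = refl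
  cellEdge-uncellEdge o (choose both σ τ) (left e)   = cong left (doubleEdge-undoubleEdge σ e)
  cellEdge-uncellEdge o (choose both σ τ) (right e)  = refl

  ends-cellEdge : ∀ o (σ : Switching (cellFormula o)) e →
                  parent (cellEdge o σ e) ≡ cellNode o (parent e) ×
                  child (cellEdge o σ e) ≡ cellNode o (child e)
  ends-cellEdge o (choose both σ τ) (here leftSide _)  = refl , refl
  ends-cellEdge o (choose both σ τ) (here rightSide _) = refl , refl
  ends-cellEdge o (choose both σ τ) (left e)           =
    Product.map (cong left) (cong left) (ends-doubleEdge σ e)
  ends-cellEdge o (choose both σ τ) (right e)          = refl , refl

  module _ (σ : Switching (dual ⟦ A ⟧)) where

    edge : (ℓ : Labels m) (ζ : CellSwitchings ℓ) (κ : Fin m → Side) →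
           PartEdge ℓ σ ζ → TreeEdge (assemble ℓ σ ζ κ)
    edge {zero}  ℓ ζ κ (base e)         = e
    edge {suc m} ℓ ζ κ (base e)         = right (edge (ℓ ⊚ suc) (ζ ⊚ suc) (κ ⊚ suc) (base e))
    edge         ℓ ζ κ (cell zero e)    = left (cellEdge (ℓ zero) (ζ zero) e)
    edge         ℓ ζ κ (cell (suc i) e) = right (edge (ℓ ⊚ suc) (ζ ⊚ suc) (κ ⊚ suc) (cell i e))
    edge         ℓ ζ κ (outer zero)     = here (κ zero) only
    edge         ℓ ζ κ (outer (suc i))  = right (edge (ℓ ⊚ suc) (ζ ⊚ suc) (κ ⊚ suc) (outer i))

    partEdge : (ℓ : Labels m) (ζ : CellSwitchings ℓ) (κ : Fin m → Side) →
               TreeEdge (assemble ℓ σ ζ κ) → PartEdge ℓ σ ζ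
    partEdge {zero}  ℓ ζ κ e             = base e
    partEdge {suc m} ℓ ζ κ (here _ only) = outer zero
    partEdge {suc m} ℓ ζ κ (left e)      = cell zero (uncellEdge (ℓ zero) (ζ zero) e)
    partEdge {suc m} ℓ ζ κ (right e)     = laterEdge (partEdge (ℓ ⊚ suc) (ζ ⊚ suc) (κ ⊚ suc) e)

    edge-later : (ℓ : Labels (suc m)) (ζ : CellSwitchings ℓ) (κ : Fin (suc m) → Side) →
                 ∀ x → edge ℓ ζ κ (laterEdge x) ≡ right (edge (ℓ ⊚ suc) (ζ ⊚ suc) (κ ⊚ suc) x)
    edge-later ℓ ζ κ (base e)   = refl
    edge-later ℓ ζ κ (cell i e) = refl
    edge-later ℓ ζ κ (outer i)  = refl

    partEdge-edge : (ℓ : Labels m) (ζ : CellSwitchings ℓ) (κ : Fin m → Side) →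
                    ∀ x → partEdge ℓ ζ κ (edge ℓ ζ κ x) ≡ x
    partEdge-edge {zero}  ℓ ζ κ (base e)         = refl
    partEdge-edge {suc m} ℓ ζ κ (base e)         =
      cong laterEdge (partEdge-edge (ℓ ⊚ suc) (ζ ⊚ suc) (κ ⊚ suc) (base e))
    partEdge-edge         ℓ ζ κ (cell zero e)    =
      cong (cell zero) (uncellEdge-cellEdge (ℓ zero) (ζ zero) e)
    partEdge-edge         ℓ ζ κ (cell (suc i) e) =
      cong laterEdge (partEdge-edge (ℓ ⊚ suc) (ζ ⊚ suc) (κ ⊚ suc) (cell i e))
    partEdge-edge         ℓ ζ κ (outer zero)     = refl
    partEdge-edge         ℓ ζ κ (outer (suc i))  =
      cong laterEdge (partEdge-edge (ℓ ⊚ suc) (ζ ⊚ suc) (κ ⊚ suc) (outer i))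

    edge-partEdge : (ℓ : Labels m) (ζ : CellSwitchings ℓ) (κ : Fin m → Side) →
                    ∀ e → edge ℓ ζ κ (partEdge ℓ ζ κ e) ≡ e
    edge-partEdge {zero}  ℓ ζ κ e             = refl
    edge-partEdge {suc m} ℓ ζ κ (here _ only) = refl
    edge-partEdge {suc m} ℓ ζ κ (left e)      = cong left (cellEdge-uncellEdge (ℓ zero) (ζ zero) e)
    edge-partEdge {suc m} ℓ ζ κ (right e)     =
      trans (edge-later ℓ ζ κ (partEdge (ℓ ⊚ suc) (ζ ⊚ suc) (κ ⊚ suc) e))
            (cong right (edge-partEdge (ℓ ⊚ suc) (ζ ⊚ suc) (κ ⊚ suc) e))

    ends-base : (ℓ : Labels m) (ζ : CellSwitchings ℓ) (κ : Fin m → Side) → ∀ e →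
                parent (edge ℓ ζ κ (base e)) ≡ core ℓ (base (parent e)) ×
                child (edge ℓ ζ κ (base e)) ≡ core ℓ (base (child e))
    ends-base {zero}  ℓ ζ κ e = refl , refl
    ends-base {suc m} ℓ ζ κ e =
      Product.map (cong right) (cong right) (ends-base (ℓ ⊚ suc) (ζ ⊚ suc) (κ ⊚ suc) e)

    ends-cell : (ℓ : Labels m) (ζ : CellSwitchings ℓ) (κ : Fin m → Side) → ∀ i e →
                parent (edge ℓ ζ κ (cell i e)) ≡ core ℓ (cell i (parent e)) ×
                child (edge ℓ ζ κ (cell i e)) ≡ core ℓ (cell i (child e))
    ends-cell ℓ ζ κ zero    e =
      Product.map (cong left) (cong left) (ends-cellEdge (ℓ zero) (ζ zero) e)
    ends-cell ℓ ζ κ (suc i) e =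
      Product.map (cong right) (cong right) (ends-cell (ℓ ⊚ suc) (ζ ⊚ suc) (κ ⊚ suc) i e)

    -- With the left choice the lower end is always the root of a cell; with the right one it could
    -- be the next outer ⅋.
    ends-outer : (ℓ : Labels m) (ζ : CellSwitchings ℓ) → ∀ i →
                 parent (edge ℓ ζ (λ _ → leftSide) (outer i)) ≡ outerNode ℓ i ×
                 child (edge ℓ ζ (λ _ → leftSide) (outer i)) ≡ core ℓ (cell i root)
    ends-outer ℓ ζ zero    = refl , refl
    ends-outer ℓ ζ (suc i) =
      Product.map (cong right) (cong right) (ends-outer (ℓ ⊚ suc) (ζ ⊚ suc) i)

  -- The outer ⅋s which the edge of the i-th one separates from the core nodes.
  side : (ℓ : Labels m) (κ : Fin m → Side) → Fin m → Node (dual ⟦ absorb m ℓ ⟧) → Bool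
  side ℓ κ zero    root      = true
  side ℓ κ zero    (left _)  = false
  side ℓ κ zero    (right _) = false
  -- An earlier ⅋ is on this side only if right edges lead from it all the way down to the chosen
  -- one.
  side ℓ κ (suc i) root with κ zero
  ... | leftSide             = false
  ... | rightSide            = side (ℓ ⊚ suc) (κ ⊚ suc) i root
  side ℓ κ (suc i) (left _)  = false
  side ℓ κ (suc i) (right n) = side (ℓ ⊚ suc) (κ ⊚ suc) i n

  side-core : (ℓ : Labels m) (κ : Fin m → Side) (i : Fin m) (x : CoreNode ℓ) →
              side ℓ κ i (core ℓ x) ≡ false
  side-core ℓ κ zero    (base n)         = refl
  side-core ℓ κ zero    (cell zero n)    = refl
  side-core ℓ κ zero    (cell (suc j) n) = refl
  side-core ℓ κ (suc i) (base n)         = side-core (ℓ ⊚ suc) (κ ⊚ suc) i (base n)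
  side-core ℓ κ (suc i) (cell zero n)    = refl
  side-core ℓ κ (suc i) (cell (suc j) n) = side-core (ℓ ⊚ suc) (κ ⊚ suc) i (cell j n)

  module _ (σ : Switching (dual ⟦ A ⟧)) where

    side-separates : (ℓ : Labels m) (ζ : CellSwitchings ℓ) (κ : Fin m → Side) (i : Fin m) →
                     side ℓ κ i (parent (edge σ ℓ ζ κ (outer i))) ≢
                     side ℓ κ i (child (edge σ ℓ ζ κ (outer i)))
    side-separates ℓ ζ κ zero with κ zero
    ... | leftSide  = λ ()
    ... | rightSide = λ ()
    side-separates ℓ ζ κ (suc i) = side-separates (ℓ ⊚ suc) (ζ ⊚ suc) (κ ⊚ suc) i

    side-preserves : (ℓ : Labels m) (ζ : CellSwitchings ℓ) (κ : Fin m → Side) (i : Fin m) →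
                     (e : TreeEdge (assemble ℓ σ ζ κ)) → edge σ ℓ ζ κ (outer i) ≢ e →
                     side ℓ κ i (parent e) ≡ side ℓ κ i (child e)
    side-preserves ℓ ζ κ zero    (here _ only)  ne = ⊥-elim (ne refl)
    side-preserves ℓ ζ κ zero    (left e)       ne = refl
    side-preserves ℓ ζ κ zero    (right e)      ne = refl
    side-preserves ℓ ζ κ (suc i) (here k kept)  ne with κ zero
    side-preserves ℓ ζ κ (suc i) (here leftSide only)  ne | leftSide  = refl
    side-preserves ℓ ζ κ (suc i) (here rightSide only) ne | rightSide = refl
    side-preserves ℓ ζ κ (suc i) (left e)       ne = refl
    side-preserves ℓ ζ κ (suc i) (right e)      ne =
      side-preserves (ℓ ⊚ suc) (ζ ⊚ suc) (κ ⊚ suc) i e (ne ⊚ cong right)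

    module _ {H : Graph} where

      -- A left edge enters a cell, and a right edge leads to the next ⅋ or finally to `A`, so
      -- following the kept edges ends at a core node. The map `h` places the tree in a larger graph
      -- and is general so that the recursion can pass to right subtrees.
      reach-root : (ℓ : Labels m) (ζ : CellSwitchings ℓ) (κ : Fin m → Side)
                   (h : Node (dual ⟦ absorb m ℓ ⟧) → Graph.Vertex H) →
                   (∀ (e : TreeEdge (assemble ℓ σ ζ κ)) → Graph.Walk H (h (parent e)) (h (child e))) →
                   ∃[ x ] Graph.Walk H (h root) (h (core ℓ x))
      reach-root {zero}  ℓ ζ κ h w = base root , Graph.[]
      reach-root {suc m} ℓ ζ κ h w with κ zero | w (here (κ zero) only)
      ... | leftSide  | p = cell zero root , p
      ... | rightSide | p =
        Product.map laterNode (λ {x} q → subst (Graph.Walk H _ ⊚ h) (sym (core-later ℓ x)) (p ▷ q))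
          (reach-root (ℓ ⊚ suc) (ζ ⊚ suc) (κ ⊚ suc) (h ⊚ right) (w ⊚ right))

      reach-core : (ℓ : Labels m) (ζ : CellSwitchings ℓ) (κ : Fin m → Side)
                   (h : Node (dual ⟦ absorb m ℓ ⟧) → Graph.Vertex H) →
                   (∀ (e : TreeEdge (assemble ℓ σ ζ κ)) → Graph.Walk H (h (parent e)) (h (child e))) →
                   ∀ i → ∃[ x ] Graph.Walk H (h (outerNode ℓ i)) (h (core ℓ x))
      reach-core ℓ ζ κ h w zero    = reach-root ℓ ζ κ h w
      reach-core ℓ ζ κ h w (suc i) =
        Product.map laterNode (λ {x} q → subst (Graph.Walk H _ ⊚ h) (sym (core-later ℓ x)) q)
          (reach-core (ℓ ⊚ suc) (ζ ⊚ suc) (κ ⊚ suc) (h ⊚ right) (w ⊚ right) i)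

-- Ports as leaves of the syntax tree

module _ {X : Set} where

  dualLeaf : (P : Classical X) → Leaf P → Leaf (dual P)
  dualLeaf (lit _ _)   x        = x
  dualLeaf (P ⟨ _ ⟩ Q) (inj₁ x) = inj₁ (dualLeaf P x)
  dualLeaf (P ⟨ _ ⟩ Q) (inj₂ x) = inj₂ (dualLeaf Q x)

  undualLeaf : (P : Classical X) → Leaf (dual P) → Leaf P
  undualLeaf (lit _ _)   x        = x
  undualLeaf (P ⟨ _ ⟩ Q) (inj₁ x) = inj₁ (undualLeaf P x)
  undualLeaf (P ⟨ _ ⟩ Q) (inj₂ x) = inj₂ (undualLeaf Q x)

  undualLeaf-dualLeaf : (P : Classical X) (x : Leaf P) → undualLeaf P (dualLeaf P x) ≡ x
  undualLeaf-dualLeaf (lit _ _)   x        = refl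
  undualLeaf-dualLeaf (P ⟨ _ ⟩ Q) (inj₁ x) = cong inj₁ (undualLeaf-dualLeaf P x)
  undualLeaf-dualLeaf (P ⟨ _ ⟩ Q) (inj₂ x) = cong inj₂ (undualLeaf-dualLeaf Q x)

  dualLeaf-undualLeaf : (P : Classical X) (x : Leaf (dual P)) → dualLeaf P (undualLeaf P x) ≡ x
  dualLeaf-undualLeaf (lit _ _)   x        = refl
  dualLeaf-undualLeaf (P ⟨ _ ⟩ Q) (inj₁ x) = cong inj₁ (dualLeaf-undualLeaf P x)
  dualLeaf-undualLeaf (P ⟨ _ ⟩ Q) (inj₂ x) = cong inj₂ (dualLeaf-undualLeaf Q x)

  dualLink-dualLeaf : (P : Classical X) (x : Leaf P) {n : Node P} →
                      dualLink P x ≡ (dualNode n , n) →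
                      dualLink (dual P) (dualLeaf P x) ≡ (dualNode (dualNode n) , dualNode n)
  dualLink-dualLeaf (lit _ _)   x        {root}    eq = refl
  dualLink-dualLeaf (P ⟨ _ ⟩ Q) (inj₁ x) eq with dualLink P x | dualLink-dualLeaf P x
  dualLink-dualLeaf (P ⟨ _ ⟩ Q) (inj₁ x) refl | _ | ih = cong (Product.map left left) (ih refl)
  dualLink-dualLeaf (P ⟨ _ ⟩ Q) (inj₂ x) eq with dualLink Q x | dualLink-dualLeaf Q x
  dualLink-dualLeaf (P ⟨ _ ⟩ Q) (inj₂ x) refl | _ | ih = cong (Product.map right right) (ih refl)

  toLeaf : ∀ {A : Formula X} {s t} → Port A s t → Leaf ⟦ A ⟧
  toLeaf var            = tt
  toLeaf I              = tt
  toLeaf (⊗ˡ p)         = inj₁ (toLeaf p)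
  toLeaf (⊗ʳ p)         = inj₂ (toLeaf p)
  toLeaf (⊸ˡ {A = A} p) = inj₁ (dualLeaf ⟦ A ⟧ (toLeaf p))
  toLeaf (⊸ʳ p)         = inj₂ (toLeaf p)

  dualLink-toLeaf : ∀ {A : Formula X} {s t} (p : Port A s t) →
                    dualLink ⟦ A ⟧ (toLeaf p) ≡ (dualNode (leaf p) , leaf p)
  dualLink-toLeaf var    = refl
  dualLink-toLeaf I      = refl
  dualLink-toLeaf (⊗ˡ p) = cong (Product.map left left) (dualLink-toLeaf p)
  dualLink-toLeaf (⊗ʳ p) = cong (Product.map right right) (dualLink-toLeaf p)
  dualLink-toLeaf (⊸ˡ p) =
    cong (Product.map left left) (dualLink-dualLeaf _ (toLeaf p) (dualLink-toLeaf p))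
  dualLink-toLeaf (⊸ʳ p) = cong (Product.map right right) (dualLink-toLeaf p)

  APort : Formula X → Set
  APort A = Σ[ s ∈ Sign ] Σ[ t ∈ Atom X ] Port A s t

  -- The equation between `opposite s` and `opposite s′` can be matched only once both signs are
  -- known.
  ⊸ˡ-cong : ∀ {A B : Formula X} {s s′ t t′} {p : Port A (opposite s) t} {p′ : Port A (opposite s′) t′} →
            _≡_ {A = APort A} (opposite s , t , p) (opposite s′ , t′ , p′) →
            _≡_ {A = APort (A ⊸ B)} (s , t , ⊸ˡ p) (s′ , t′ , ⊸ˡ p′)
  ⊸ˡ-cong {s = ⁺} {⁺} refl = refl
  ⊸ˡ-cong {s = ⁻} {⁻} refl = refl

  -- A leaf also determines the polarity and the atom of its port, hence the equality of triples. It
  -- keeps distinct wires of the first factor on distinct links.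
  toLeaf-injective : ∀ {A : Formula X} {s s′ t t′} (p : Port A s t) (p′ : Port A s′ t′) →
                     toLeaf p ≡ toLeaf p′ → _≡_ {A = APort A} (s , t , p) (s′ , t′ , p′)
  toLeaf-injective var    var     _  = refl
  toLeaf-injective I      I       _  = refl
  toLeaf-injective (⊗ˡ p) (⊗ˡ p′) eq with toLeaf-injective p p′ (inj₁-injective eq)
  ... | refl = refl
  toLeaf-injective (⊗ʳ p) (⊗ʳ p′) eq with toLeaf-injective p p′ (inj₂-injective eq)
  ... | refl = refl
  toLeaf-injective (⊸ˡ {A = A} p) (⊸ˡ p′) eq =
    ⊸ˡ-cong (toLeaf-injective p p′
      (trans (sym (undualLeaf-dualLeaf ⟦ A ⟧ _))
             (trans (cong (undualLeaf ⟦ A ⟧) (inj₁-injective eq)) (undualLeaf-dualLeaf ⟦ A ⟧ _))))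
  toLeaf-injective (⊸ʳ p) (⊸ʳ p′) eq with toLeaf-injective p p′ (inj₂-injective eq)
  ... | refl = refl

  toLeaf-surjective : (A : Formula X) (x : Leaf ⟦ A ⟧) →
                      Σ[ s ∈ Sign ] Σ[ t ∈ Atom X ] Σ[ p ∈ Port A s t ] toLeaf p ≡ x
  toLeaf-surjective (var x) tt = _ , _ , var , refl
  toLeaf-surjective I       tt = _ , _ , I , refl
  toLeaf-surjective (A ⊗ B) (inj₁ x) with toLeaf-surjective A x
  ... | _ , _ , p , refl = _ , _ , ⊗ˡ p , refl
  toLeaf-surjective (A ⊗ B) (inj₂ x) with toLeaf-surjective B x
  ... | _ , _ , p , refl = _ , _ , ⊗ʳ p , refl
  toLeaf-surjective (A ⊸ B) (inj₁ x)
    with toLeaf-surjective A (undualLeaf ⟦ A ⟧ x) | dualLeaf-undualLeaf ⟦ A ⟧ x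
  ... | ⁺ , _ , p , eq | eq′ = ⁻ , _ , ⊸ˡ p , cong inj₁ (trans (cong (dualLeaf ⟦ A ⟧) eq) eq′)
  ... | ⁻ , _ , p , eq | eq′ = ⁺ , _ , ⊸ˡ p , cong inj₁ (trans (cong (dualLeaf ⟦ A ⟧) eq) eq′)
  toLeaf-surjective (A ⊸ B) (inj₂ x) with toLeaf-surjective B x
  ... | _ , _ , p , refl = _ , _ , ⊸ʳ p , refl

-- The first factor

module Collection (S : Signature) (A : Formula (Signature.Sort S)) {m : ℕ} (ℓ : Fin m → Operation S) where
  open Signature S
  open ProofNets S
  open Absorption S A

  D : Fml
  D = absorb m ℓ

  outerPort : ∀ {s t} → Part ℓ s t → GPort A D ℓ s t
  outerPort (base p)  = dom p
  outerPort (arg i p) = arg i p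
  outerPort (res i p) = res i p

  -- The ports of `A` and of the cells together play the domain of an identity linking on `D`; each
  -- is paired with its copy in the codomain.
  across⁻ : ∀ {t} → GPort A D ℓ ⁻ t → GPort A D ℓ ⁺ t
  across⁻ (dom p)   = cod (port {s = ⁻} ℓ (base p))
  across⁻ (cod d)   = outerPort (part {s = ⁺} ℓ d)
  across⁻ (arg i p) = cod (port {s = ⁻} ℓ (arg i p))
  across⁻ (res i p) = cod (port {s = ⁻} ℓ (res i p))

  across⁺ : ∀ {t} → GPort A D ℓ ⁺ t → GPort A D ℓ ⁻ t
  across⁺ (dom p)   = cod (port {s = ⁺} ℓ (base p))
  across⁺ (cod d)   = outerPort (part {s = ⁻} ℓ d)
  across⁺ (arg i p) = cod (port {s = ⁺} ℓ (arg i p))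
  across⁺ (res i p) = cod (port {s = ⁺} ℓ (res i p))

  across⁻-outer : ∀ {t} (x : Part ℓ ⁻ t) → across⁻ (outerPort x) ≡ cod (port ℓ x)
  across⁻-outer (base p)  = refl
  across⁻-outer (arg i p) = refl
  across⁻-outer (res i p) = refl

  across⁺-outer : ∀ {t} (x : Part ℓ ⁺ t) → across⁺ (outerPort x) ≡ cod (port ℓ x)
  across⁺-outer (base p)  = refl
  across⁺-outer (arg i p) = refl
  across⁺-outer (res i p) = refl

  across⁻-across⁺ : ∀ {t} (p : GPort A D ℓ ⁺ t) → across⁻ (across⁺ p) ≡ p
  across⁻-across⁺ (dom p)   = cong outerPort (part-port ℓ (base p))
  across⁻-across⁺ (cod d)   = trans (across⁻-outer (part ℓ d)) (cong cod (port-part {s = ⁻} ℓ d))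
  across⁻-across⁺ (arg i p) = cong outerPort (part-port ℓ (arg i p))
  across⁻-across⁺ (res i p) = cong outerPort (part-port ℓ (res i p))

  across⁺-across⁻ : ∀ {t} (p : GPort A D ℓ ⁻ t) → across⁺ (across⁻ p) ≡ p
  across⁺-across⁻ (dom p)   = cong outerPort (part-port ℓ (base p))
  across⁺-across⁻ (cod d)   = trans (across⁺-outer (part ℓ d)) (cong cod (port-part {s = ⁺} ℓ d))
  across⁺-across⁻ (arg i p) = cong outerPort (part-port ℓ (arg i p))
  across⁺-across⁻ (res i p) = cong outerPort (part-port ℓ (res i p))

  collection : Linking A D ℓ
  collection = record
    { sorts = λ _ → mk↔ₛ′ across⁻ across⁺ across⁻-across⁺ across⁺-across⁻
    -- Units are wired to their own copies, so unit wires too correspond one to one to links of the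
    -- identity graph.
    ; units = λ p → just (unit , across⁻ p)
    }

  open Linking collection

  wireAcross : ∀ {t} (p : GPort A D ℓ ⁻ t) → Wire p (across⁻ p)
  wireAcross {sort _} p = sort refl
  wireAcross {unit}   p = unit refl

  -- Every wire, in whichever direction it runs, has exactly one end in `D`; that port names the
  -- link which the wire becomes.
  dPort : ∀ {t} → GPort A D ℓ ⁻ t → Σ[ s ∈ Sign ] Port D s t
  dPort (dom p)   = ⁺ , port {s = ⁻} ℓ (base p)
  dPort (cod d)   = ⁻ , d
  dPort (arg i p) = ⁺ , port {s = ⁻} ℓ (arg i p)
  dPort (res i p) = ⁺ , port {s = ⁻} ℓ (res i p)

  sourceOf : ∀ s {t} → Port D s t → GPort A D ℓ ⁻ t
  sourceOf ⁺ d = outerPort (part {s = ⁻} ℓ d)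
  sourceOf ⁻ d = cod d

  sourceOf-dPort : ∀ {t} (p : GPort A D ℓ ⁻ t) → sourceOf _ (proj₂ (dPort p)) ≡ p
  sourceOf-dPort (dom p)   = cong outerPort (part-port ℓ (base p))
  sourceOf-dPort (cod d)   = refl
  sourceOf-dPort (arg i p) = cong outerPort (part-port ℓ (arg i p))
  sourceOf-dPort (res i p) = cong outerPort (part-port ℓ (res i p))

  dPort-injective : ∀ {t t′} (p : GPort A D ℓ ⁻ t) (p′ : GPort A D ℓ ⁻ t′) →
                    _≡_ {A = APort D} (proj₁ (dPort p) , t , proj₂ (dPort p))
                                      (proj₁ (dPort p′) , t′ , proj₂ (dPort p′)) →
                    _≡_ {A = ∃[ u ] GPort A D ℓ ⁻ u} (t , p) (t′ , p′)
  dPort-injective p p′ eq =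
    trans (cong (_ ,_) (sym (sourceOf-dPort p)))
      (trans (cong (λ (s , t , d) → t , sourceOf s d) eq) (cong (_ ,_) (sourceOf-dPort p′)))

  module _ (σ : LinkingSwitching) where
    open LinkingSwitching σ

    -- No outer ⅋ occurs in the first factor, so its choice is free; one fixed choice serves every
    -- switching `σ`.
    L : Graph
    L = linked (assemble ℓ domσ cellσ (λ _ → leftSide)) codσ (dualLink ⟦ D ⟧)

    tree : Tree L
    tree = tree-dualLink ⟦ D ⟧ (assemble ℓ domσ cellσ (λ _ → leftSide)) codσ

    toVertex : Vertex → Graph.Vertex L
    toVertex (dom n)    = inj₁ (core ℓ (base n))
    toVertex (cod n)    = inj₂ n
    toVertex (cell c n) = inj₁ (core ℓ (cell c n))

    partEdgeᴸ : PartEdge ℓ domσ cellσ → Graph.Edge L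
    partEdgeᴸ x = first (edge domσ ℓ cellσ (λ _ → leftSide) x)

    toEdge : SwitchedEdge σ → Graph.Edge L
    toEdge (dom e)          = partEdgeᴸ (base e)
    toEdge (cod e)          = second e
    toEdge (cell c e)       = partEdgeᴸ (cell c e)
    toEdge (wire {p = p} _) = link (toLeaf (proj₂ (dPort p)))

    first-injective : ∀ {E F K : Set} {x y : E} →
                      _≡_ {A = LinkedEdge E F K} (first x) (first y) → x ≡ y
    first-injective refl = refl

    partEdgeᴸ-injective : ∀ x y → partEdgeᴸ x ≡ partEdgeᴸ y → x ≡ y
    partEdgeᴸ-injective x y eq =
      trans (sym (partEdge-edge domσ ℓ cellσ _ x))
        (trans (cong (partEdge domσ ℓ cellσ _) (first-injective eq))
               (partEdge-edge domσ ℓ cellσ _ y))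

    link-injective : ∀ {E F K : Set} {x y : K} →
                     _≡_ {A = LinkedEdge E F K} (link x) (link y) → x ≡ y
    link-injective refl = refl

    wire-unique : ∀ {t u u′} {p : GPort A D ℓ ⁻ t} {q : GPort A D ℓ ⁺ u} {q′ : GPort A D ℓ ⁺ u′}
                  (w : Wire p q) (w′ : Wire p q′) →
                  _≡_ {A = SwitchedEdge σ} (wire w) (wire w′)
    wire-unique (sort refl) (sort refl) = refl
    wire-unique (unit refl) (unit refl) = refl

    toEdge-injective : ∀ {e e′} → toEdge e ≡ toEdge e′ → e ≡ e′
    toEdge-injective {dom e}    {dom e′}     eq with partEdgeᴸ-injective (base e) (base e′) eq
    ... | refl = refl
    toEdge-injective {dom e}    {cell c′ e′} eq with partEdgeᴸ-injective (base e) (cell c′ e′) eq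
    ... | ()
    toEdge-injective {cell c e} {dom e′}     eq with partEdgeᴸ-injective (cell c e) (base e′) eq
    ... | ()
    toEdge-injective {cell c e} {cell c′ e′} eq with partEdgeᴸ-injective (cell c e) (cell c′ e′) eq
    ... | refl = refl
    toEdge-injective {cod e}    {cod .e}     refl = refl
    toEdge-injective {wire {p = p} w} {wire {p = p′} w′} eq
      with dPort-injective p p′ (toLeaf-injective _ _ (link-injective eq))
    ... | refl = wire-unique w w′

    vertex-outer : ∀ {s t} (x : Part ℓ s t) →
                   toVertex (vertex (outerPort x)) ≡ inj₁ (dualNode (leaf (port ℓ x)))
    vertex-outer (base p)  = cong inj₁ (sym (leaf-port ℓ (base p)))
    vertex-outer (arg i p) = cong inj₁ (sym (leaf-port ℓ (arg i p)))
    vertex-outer (res i p) = cong inj₁ (sym (leaf-port ℓ (res i p)))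

    joins-outer : ∀ {s t} (x : Part ℓ s t) (d : Port D (opposite s) t) → port ℓ x ≡ d →
                  Graph.ends L (link (toLeaf d)) ≡
                  (toVertex (vertex (outerPort x)) , toVertex (vertex (cod {s = opposite s} d)))
    joins-outer x d refl = trans (cong (Product.map inj₁ inj₂) (dualLink-toLeaf d))
                                 (cong₂ _,_ (sym (vertex-outer x)) refl)

    joins-wire : ∀ {t} (p : GPort A D ℓ ⁻ t) →
                 Graph.Joins L (link (toLeaf (proj₂ (dPort p)))) (toVertex (vertex p))
                             (toVertex (vertex (across⁻ p)))
    joins-wire (dom p)   = inj₁ (joins-outer {⁻} (base p) _ refl)
    joins-wire (cod d)   = inj₂ (joins-outer {⁺} (part ℓ d) d (port-part {s = ⁺} ℓ d))
    joins-wire (arg i p) = inj₁ (joins-outer {⁻} (arg i p) _ refl)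
    joins-wire (res i p) = inj₁ (joins-outer {⁻} (res i p) _ refl)

    toHom : Hom (switchedGraph σ) L
    toHom = record
      { vertex = toVertex
      ; edge   = toEdge
      ; joins  = λ where
          (dom e)    → let p , c = ends-base domσ ℓ cellσ (λ _ → leftSide) e in
                       inj₁ (cong₂ _,_ (cong inj₁ p) (cong inj₁ c))
          (cod e)    → inj₁ refl
          (cell c e) → let p , c = ends-cell domσ ℓ cellσ (λ _ → leftSide) c e in
                       inj₁ (cong₂ _,_ (cong inj₁ p) (cong inj₁ c))
          (wire {p = p} (sort refl)) → joins-wire p
          (wire {p = p} (unit refl)) → joins-wire p
      }

    G : Graph
    G = switchedGraph σ

    coreVertex : CoreNode ℓ → Vertex
    coreVertex (base n)   = dom n
    coreVertex (cell i n) = cell i n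

    -- With all ⅋s switched to the left, the i-th one hangs on the i-th cell.
    contract : Graph.Vertex L → Vertex
    contract (inj₁ n) = [ coreVertex , (λ i → cell i root) ] (classify ℓ n)
    contract (inj₂ n) = cod n

    contract-core : ∀ {n} x → n ≡ core ℓ x → contract (inj₁ n) ≡ coreVertex x
    contract-core x refl = cong [ coreVertex , _ ] (classify-core ℓ x)

    contract-outer : ∀ {n} i → n ≡ outerNode ℓ i → contract (inj₁ n) ≡ cell i root
    contract-outer i refl = cong [ coreVertex , _ ] (classify-outer ℓ i)

    walk-between : ∀ {u v u′ v′} → u′ ≡ u → v′ ≡ v → Graph.Walk G u v → Graph.Walk G u′ v′
    walk-between refl refl w = w

    contract-edge : ∀ e → Graph.Walk G (contract (inj₁ (parent e))) (contract (inj₁ (child e)))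
    -- Writing `e` as the image of its classification exposes its three possible origins.
    contract-edge e = subst (λ e → Graph.Walk G (contract (inj₁ (parent e))) (contract (inj₁ (child e))))
                            (edge-partEdge domσ ℓ cellσ _ e) (walk (partEdge domσ ℓ cellσ _ e))
      where
      walk : ∀ x → let e = edge domσ ℓ cellσ (λ _ → leftSide) x in
             Graph.Walk G (contract (inj₁ (parent e))) (contract (inj₁ (child e)))
      walk (base e)   = let p , c = ends-base domσ ℓ cellσ _ e in
                        walk-between (contract-core _ p) (contract-core _ c) (along (dom e))
      walk (cell i e) = let p , c = ends-cell domσ ℓ cellσ _ i e in
                        walk-between (contract-core _ p) (contract-core _ c) (along (cell i e))
      walk (outer i)  = let p , c = ends-outer domσ ℓ cellσ i in
                        diagonal (trans (contract-outer i p) (sym (contract-core _ c)))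

    contract-port : ∀ {s t} (d : Port D (opposite s) t) →
                    contract (inj₁ (dualNode (leaf d))) ≡ vertex (outerPort (part {s = s} ℓ d))
    contract-port {s} d =
      trans (contract-core (leafNode ℓ (part {s = s} ℓ d))
              (trans (cong (dualNode ⊚ leaf) (sym (port-part {s = s} ℓ d))) (leaf-port ℓ (part {s = s} ℓ d))))
            (coreVertex-leafNode (part {s = s} ℓ d))
      where
      coreVertex-leafNode : ∀ {s t} (x : Part ℓ s t) →
                            coreVertex (leafNode ℓ x) ≡ vertex (outerPort x)
      coreVertex-leafNode (base p)  = refl
      coreVertex-leafNode (arg i p) = refl
      coreVertex-leafNode (res i p) = refl

    contract-link : ∀ x → Graph.Walk G (contract (inj₁ (proj₁ (dualLink ⟦ D ⟧ x))))
                                       (contract (inj₂ (proj₂ (dualLink ⟦ D ⟧ x))))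
    contract-link x with toLeaf-surjective D x
    ... | s , _ , d , refl rewrite dualLink-toLeaf d = walk s d
      where
      walk : ∀ s {t} (d : Port D s t) → Graph.Walk G (contract (inj₁ (dualNode (leaf d)))) (cod (leaf d))
      walk ⁺ d = walk-between (contract-port {⁻} d) refl
        (subst (λ q → Graph.Walk G (vertex (outerPort (part {s = ⁻} ℓ d))) (vertex q))
               (trans (across⁻-outer (part {s = ⁻} ℓ d)) (cong cod (port-part {s = ⁻} ℓ d)))
               (along (wire (wireAcross (outerPort (part {s = ⁻} ℓ d))))))
      walk ⁻ d = walk-between (contract-port {⁺} d) refl
        (reverse (along (wire (wireAcross (cod d)))))

    collection-acyclic : Graph.Acyclic G
    collection-acyclic =
      cuts⇒acyclic λ e → pullback-cut toHom toEdge-injective (Tree.cut tree (toEdge e))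

    collection-connected : Graph.Connected G
    collection-connected = connected-along contract
      (λ { (first e) → contract-edge e ; (second e) → along (cod e) ; (link x) → contract-link x })
      (λ where
        (dom n)    → inj₁ (core ℓ (base n)) , diagonal (sym (contract-core (base n) refl))
        (cod n)    → inj₂ n , Graph.[]
        (cell i n) → inj₁ (core ℓ (cell i n)) , diagonal (sym (contract-core (cell i n) refl)))
      (Tree.connected tree)

  collection-correct : Correct
  collection-correct = record
    { total     = λ p → _ , _ , wireAcross p
    ; acyclic   = collection-acyclic
    ; connected = collection-connected
    }

-- Matching on a view of c turns ℓ c into ℓ (k₁ i) or ℓ (k₂ j) by computation, so that no port
-- or switching has to be transported along an equation between labels.
module _ {n m₁ m₂ : ℕ} (k₁ : Fin m₁ → Fin n) (k₂ : Fin m₂ → Fin n) where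

  data View : Fin n → Set where
    inL : ∀ i → View (k₁ i)
    inR : ∀ j → View (k₂ j)

  record Splitting : Set where
    field
      view    : ∀ c → View c
      view-k₁ : ∀ i → view (k₁ i) ≡ inL i
      view-k₂ : ∀ j → view (k₂ j) ≡ inR j

-- The second factor

module Absorb (S : Signature) {A B : Formula (Signature.Sort S)} {n m₁ m₂ : ℕ} {ℓ : Fin n → Operation S}
              {k₁ : Fin m₁ → Fin n} {k₂ : Fin m₂ → Fin n} (splitting : Splitting k₁ k₂)
              (f : ProofNets.Linking S A B ℓ) (correct : ProofNets.Linking.Correct f) where
  open Signature S
  open ProofNets S
  open Operation
  open Absorption S A
  open Splitting splitting

  ℓ₁ : Fin m₁ → Operation S
  ℓ₁ = ℓ ⊚ k₁

  ℓ₂ : Fin m₂ → Operation S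
  ℓ₂ = ℓ ⊚ k₂

  D : Fml
  D = absorb m₁ ℓ₁

  intoArg : ∀ {c s t} → View k₁ k₂ c → Port (source (ℓ c)) s t → GPort D B ℓ₂ s t
  intoArg (inL i) p = dom (port ℓ₁ (arg i p))
  intoArg (inR j) p = arg j p

  intoRes : ∀ {c s t} → View k₁ k₂ c → Port (target (ℓ c)) (opposite s) t → GPort D B ℓ₂ s t
  intoRes (inL i) p = dom (port ℓ₁ (res i p))
  intoRes (inR j) p = res j p

  into : ∀ {s t} → GPort A B ℓ s t → GPort D B ℓ₂ s t
  into (dom p)   = dom (port ℓ₁ (base p))
  into (cod p)   = cod p
  into (arg c p) = intoArg (view c) p
  into (res c p) = intoRes (view c) p

  outOfPart : ∀ {s t} → Part ℓ₁ s t → GPort A B ℓ s t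
  outOfPart (base p)  = dom p
  outOfPart (arg i p) = arg (k₁ i) p
  outOfPart (res i p) = res (k₁ i) p

  outOf : ∀ {s t} → GPort D B ℓ₂ s t → GPort A B ℓ s t
  outOf (dom d)   = outOfPart (part ℓ₁ d)
  outOf (cod p)   = cod p
  outOf (arg j p) = arg (k₂ j) p
  outOf (res j p) = res (k₂ j) p

  into-outOfPart : ∀ {s t} (x : Part ℓ₁ s t) → into (outOfPart x) ≡ dom (port ℓ₁ x)
  into-outOfPart (base p)  = refl
  into-outOfPart (arg i p) = cong (λ v → intoArg v p) (view-k₁ i)
  into-outOfPart (res i p) = cong (λ v → intoRes v p) (view-k₁ i)

  into-outOf : ∀ {s t} (p : GPort D B ℓ₂ s t) → into (outOf p) ≡ p
  into-outOf {s} (dom d) = trans (into-outOfPart (part ℓ₁ d)) (cong dom (port-part {s = s} ℓ₁ d))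
  into-outOf (cod p)     = refl
  into-outOf (arg j p)   = cong (λ v → intoArg v p) (view-k₂ j)
  into-outOf (res j p)   = cong (λ v → intoRes v p) (view-k₂ j)

  outOf-into : ∀ {s t} (p : GPort A B ℓ s t) → outOf (into p) ≡ p
  outOf-into (dom p)   = cong outOfPart (part-port ℓ₁ (base p))
  outOf-into (cod p)   = refl
  outOf-into (arg c p) with view c
  ... | inL i = cong outOfPart (part-port ℓ₁ (arg i p))
  ... | inR j = refl
  outOf-into (res c p) with view c
  ... | inL i = cong outOfPart (part-port ℓ₁ (res i p))
  ... | inR j = refl

  module F = Linking f

  absorbed : Linking D B ℓ₂
  absorbed = record
    { sorts = λ a → let open Inverse (F.sorts a) in mk↔ₛ′
        (into ⊚ to ⊚ outOf) (into ⊚ from ⊚ outOf)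
        (λ p → trans (cong (into ⊚ to) (outOf-into _))
                     (trans (cong into (strictlyInverseˡ _)) (into-outOf p)))
        (λ p → trans (cong (into ⊚ from) (outOf-into _))
                     (trans (cong into (strictlyInverseʳ _)) (into-outOf p)))
    ; units = Maybe.map (map₂ into) ⊚ F.units ⊚ outOf
    }

  module F₂ = Linking absorbed

  intoWire : ∀ {t u} {p : GPort A B ℓ ⁻ t} {q : GPort A B ℓ ⁺ u} →
             F.Wire p q → F₂.Wire (into p) (into q)
  intoWire {p = p} (F.sort {a} eq) =
    F₂.sort (cong into (trans (cong (Inverse.to (F.sorts a)) (outOf-into p)) eq))
  intoWire {p = p} (F.unit eq) =
    F₂.unit (cong (Maybe.map (map₂ into)) (trans (cong F.units (outOf-into p)) eq))

  outOfWire : ∀ {t u} {p : GPort D B ℓ₂ ⁻ t} {q : GPort D B ℓ₂ ⁺ u} →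
              F₂.Wire p q → F.Wire (outOf p) (outOf q)
  outOfWire (F₂.sort eq) = F.sort (trans (sym (outOf-into _)) (cong outOf eq))
  outOfWire {p = p} (F₂.unit eq) with F.units (outOf p) in eq′
  outOfWire {p = p} (F₂.unit refl) | just (_ , q) =
    F.unit (trans eq′ (cong (λ q → just (_ , q)) (sym (outOf-into q))))

  -- Wires are edges of the switched graph, so an edge is recognised as an image only if any two
  -- proofs of wiring between the same ports coincide.
  wire-irrelevant : ∀ {t u} {p : GPort D B ℓ₂ ⁻ t} {q : GPort D B ℓ₂ ⁺ u} (w w′ : F₂.Wire p q) → w ≡ w′
  wire-irrelevant (F₂.sort refl) (F₂.sort refl) = refl
  wire-irrelevant (F₂.unit eq)   (F₂.unit eq′)  = cong F₂.unit (≡-irrelevant eq eq′)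

  absorbed-total : F₂.Total
  absorbed-total p with F.Correct.total correct (outOf p)
  ... | _ , _ , w = _ , _ , subst (λ p → F₂.Wire p _) (into-outOf p) (intoWire w)

  module _ (σᴬ : Switching (dual ⟦ A ⟧)) (ζ : CellSwitchings ℓ₁) (κ : Fin m₁ → Side)
           (σᴮ : Switching ⟦ B ⟧) (ζ′ : CellSwitchings ℓ₂) where

    cellσ : ∀ {c} → View k₁ k₂ c → Switching (cellFormula (ℓ c))
    cellσ (inL i) = ζ i
    cellσ (inR j) = ζ′ j

    G G₂ : Graph
    G  = F.switchedGraph record { domσ = σᴬ ; codσ = σᴮ ; cellσ = cellσ ⊚ view }
    G₂ = F₂.switchedGraph record { domσ = assemble ℓ₁ σᴬ ζ κ ; codσ = σᴮ ; cellσ = ζ′ }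

    partEdge₂ : PartEdge ℓ₁ σᴬ ζ → Graph.Edge G₂
    partEdge₂ x = F₂.dom (edge σᴬ ℓ₁ ζ κ x)

    cellVertex : ∀ {c} → View k₁ k₂ c → Node (cellFormula (ℓ c)) → F₂.Vertex
    cellVertex (inL i) n = F₂.dom (core ℓ₁ (cell i n))
    cellVertex (inR j) n = F₂.cell j n

    vertex₂ : F.Vertex → F₂.Vertex
    vertex₂ (F.dom n)    = F₂.dom (core ℓ₁ (base n))
    vertex₂ (F.cod n)    = F₂.cod n
    vertex₂ (F.cell c n) = cellVertex (view c) n

    cellEdge₂ : ∀ {c} (v : View k₁ k₂ c) → TreeEdge (cellσ v) → Graph.Edge G₂
    cellEdge₂ (inL i) e = partEdge₂ (cell i e)
    cellEdge₂ (inR j) e = F₂.cell j e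

    edge₂ : Graph.Edge G → Graph.Edge G₂
    edge₂ (F.dom e)    = partEdge₂ (base e)
    edge₂ (F.cod e)    = F₂.cod e
    edge₂ (F.cell c e) = cellEdge₂ (view c) e
    edge₂ (F.wire w)   = F₂.wire (intoWire w)

    vertex-into : ∀ {s t} (p : GPort A B ℓ s t) → F₂.vertex (into p) ≡ vertex₂ (F.vertex p)
    vertex-into (dom p)   = cong F₂.dom (leaf-port ℓ₁ (base p))
    vertex-into (cod p)   = refl
    vertex-into (arg c p) with view c
    ... | inL i = cong F₂.dom (leaf-port ℓ₁ (arg i p))
    ... | inR j = refl
    vertex-into (res c p) with view c
    ... | inL i = cong F₂.dom (leaf-port ℓ₁ (res i p))
    ... | inR j = refl

    ends-cellEdge₂ : ∀ {c} (v : View k₁ k₂ c) (e : TreeEdge (cellσ v)) →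
                     Graph.ends G₂ (cellEdge₂ v e) ≡ (cellVertex v (parent e) , cellVertex v (child e))
    ends-cellEdge₂ (inL i) e = let p , c = ends-cell σᴬ ℓ₁ ζ κ i e in
                               cong₂ _,_ (cong F₂.dom p) (cong F₂.dom c)
    ends-cellEdge₂ (inR j) e = refl

    embedding : Hom G G₂
    embedding = record
      { vertex = vertex₂
      ; edge   = edge₂
      ; joins  = λ where
          (F.dom e)    → let p , c = ends-base σᴬ ℓ₁ ζ κ e in
                         inj₁ (cong₂ _,_ (cong F₂.dom p) (cong F₂.dom c))
          (F.cod e)    → inj₁ refl
          (F.cell c e) → inj₁ (ends-cellEdge₂ (view c) e)
          (F.wire {p = p} {q} w) → inj₁ (cong₂ _,_ (vertex-into p) (vertex-into q))
      }

    coreVertex : CoreNode ℓ₁ → F.Vertex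
    coreVertex (base n)   = F.dom n
    coreVertex (cell i n) = F.cell (k₁ i) n

    vertex⁻¹ : F₂.Vertex → F.Vertex ⊎ Fin m₁
    vertex⁻¹ (F₂.dom n)    = Sum.map coreVertex id (classify ℓ₁ n)
    vertex⁻¹ (F₂.cod n)    = inj₁ (F.cod n)
    vertex⁻¹ (F₂.cell j n) = inj₁ (F.cell (k₂ j) n)

    vertex⁻¹-vertex₂ : ∀ v → vertex⁻¹ (vertex₂ v) ≡ inj₁ v
    vertex⁻¹-vertex₂ (F.dom n)    = cong (Sum.map coreVertex id) (classify-core ℓ₁ (base n))
    vertex⁻¹-vertex₂ (F.cod n)    = refl
    vertex⁻¹-vertex₂ (F.cell c n) with view c
    ... | inL i = cong (Sum.map coreVertex id) (classify-core ℓ₁ (cell i n))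
    ... | inR j = refl

    vertex₂-injective : ∀ {u v} → vertex₂ u ≡ vertex₂ v → u ≡ v
    vertex₂-injective {u} {v} eq =
      inj₁-injective (trans (sym (vertex⁻¹-vertex₂ u)) (trans (cong vertex⁻¹ eq) (vertex⁻¹-vertex₂ v)))

    vertex₂-coreVertex : ∀ x → vertex₂ (coreVertex x) ≡ F₂.dom (core ℓ₁ x)
    vertex₂-coreVertex (base n)   = refl
    vertex₂-coreVertex (cell i n) = cong (λ v → cellVertex v n) (view-k₁ i)

    image-cell : ∀ {c} {v : View k₁ k₂ c} → view c ≡ v → ∀ e →
                 ∃[ e′ ] edge₂ (F.cell c e′) ≡ cellEdge₂ v e
    image-cell refl e = e , refl

    image-wire : ∀ {t u} {p : GPort D B ℓ₂ ⁻ t} {q : GPort D B ℓ₂ ⁺ u} (w : F₂.Wire p q)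
                 {p′ q′} → into p′ ≡ p → into q′ ≡ q → (w′ : F.Wire p′ q′) →
                 edge₂ (F.wire w′) ≡ F₂.wire w
    image-wire w refl refl w′ = cong F₂.wire (wire-irrelevant _ w)

    -- Every wire ends at core nodes, never at an outer ⅋, so the labelling found inside the domain
    -- extends by `false` to the rest of the graph.
    outerSide : Fin m₁ → F₂.Vertex → Bool
    outerSide i (F₂.dom n)    = side ℓ₁ κ i n
    outerSide i (F₂.cod _)    = false
    outerSide i (F₂.cell _ _) = false

    outerSide-port : ∀ i {s t} (p : GPort D B ℓ₂ s t) → outerSide i (F₂.vertex p) ≡ false
    outerSide-port i {s} (dom d) =
      trans (cong (side ℓ₁ κ i) (trans (cong (dualNode ⊚ leaf) (sym (port-part {s = s} ℓ₁ d)))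
                                       (leaf-port ℓ₁ (part {s = s} ℓ₁ d))))
            (side-core ℓ₁ κ i (leafNode ℓ₁ (part {s = s} ℓ₁ d)))
    outerSide-port i (cod p)   = refl
    outerSide-port i (arg j p) = refl
    outerSide-port i (res j p) = refl

    cut-outer : ∀ i → Cut G₂ (partEdge₂ (outer i))
    cut-outer i = record
      { side      = outerSide i
      ; separates = side-separates σᴬ ℓ₁ ζ κ i
      ; preserves = λ where
          (F₂.dom e)    ne → side-preserves σᴬ ℓ₁ ζ κ i e (ne ⊚ cong F₂.dom)
          (F₂.cod e)    _  → refl
          (F₂.cell j e) _  → refl
          (F₂.wire {p = p} {q} w) _ → trans (outerSide-port i p) (sym (outerSide-port i q))
      }

    cut-or-image : ∀ e → Cut G₂ e ⊎ ∃[ e′ ] edge₂ e′ ≡ e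
    cut-or-image (F₂.dom e) with partEdge σᴬ ℓ₁ ζ κ e | edge-partEdge σᴬ ℓ₁ ζ κ e
    ... | base e′   | refl = inj₂ (F.dom e′ , refl)
    ... | cell i e′ | refl = inj₂ (Product.map (F.cell _) id (image-cell (view-k₁ i) e′))
    ... | outer i   | refl = inj₁ (cut-outer i)
    cut-or-image (F₂.cod e)    = inj₂ (F.cod e , refl)
    cut-or-image (F₂.cell j e) = inj₂ (Product.map (F.cell _) id (image-cell (view-k₂ j) e))
    cut-or-image (F₂.wire {p = p} {q} w) =
      inj₂ (F.wire (outOfWire w) , image-wire w (into-outOf p) (into-outOf q) (outOfWire w))

    absorbed-acyclic : Graph.Acyclic G₂
    absorbed-acyclic = acyclic-along embedding vertex₂-injective cut-or-image
                         (F.Correct.acyclic correct _)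

    reach : ∀ v → ∃[ u ] Graph.Walk G₂ v (vertex₂ u)
    reach (F₂.dom n) with classify ℓ₁ n | unclassify ℓ₁ n
    ... | inj₁ x | refl = coreVertex x , diagonal (sym (vertex₂-coreVertex x))
    -- An outer ⅋ has no counterpart in `f` and is led along the kept edges to a node that has one.
    ... | inj₂ i | refl =
      let x , w = reach-core σᴬ {G₂} ℓ₁ ζ κ F₂.dom (along ⊚ F₂.dom) i
      in coreVertex x , w ▷ diagonal (sym (vertex₂-coreVertex x))
    reach (F₂.cod n)    = F.cod n , Graph.[]
    reach (F₂.cell j n) =
      F.cell (k₂ j) n , diagonal (sym (cong (λ v → cellVertex v n) (view-k₂ j)))

    absorbed-connected : Graph.Connected G₂
    absorbed-connected = connected-along vertex₂ (hom-edge-walk embedding) reach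
                           (F.Correct.connected correct _)

  absorbed-correct : F₂.Correct
  absorbed-correct = record
    { total     = absorbed-total
    ; acyclic   = acyclic
    ; connected = connected
    }
    where
    acyclic : ∀ σ → Graph.Acyclic (F₂.switchedGraph σ)
    -- Surjectivity of `assemble` turns an arbitrary switching into one that extends a switching of
    -- `f`, to which the correctness of `f` applies.
    acyclic record { domσ = σ ; codσ = σᴮ ; cellσ = ζ′ } with assemble-surjective ℓ₁ σ
    ... | σᴬ , ζ , κ , refl = absorbed-acyclic σᴬ ζ κ σᴮ ζ′

    connected : ∀ σ → Graph.Connected (F₂.switchedGraph σ)
    connected record { domσ = σ ; codσ = σᴮ ; cellσ = ζ′ } with assemble-surjective ℓ₁ σ
    ... | σᴬ , ζ , κ , refl = absorbed-connected σᴬ ζ κ σᴮ ζ′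

-- Splittings from jointly injective enumerations

module _ {n m₁ m₂ : ℕ} {k₁ : Fin m₁ → Fin n} {k₂ : Fin m₂ → Fin n} where

  position : ∀ {c} → View k₁ k₂ c → Fin m₁ ⊎ Fin m₂
  position (inL i) = inj₁ i
  position (inR j) = inj₂ j

  lookup-position : ∀ {c} (v : View k₁ k₂ c) → [ k₁ , k₂ ] (position v) ≡ c
  lookup-position (inL i) = refl
  lookup-position (inR j) = refl

  position-injective : ∀ {c c′} (v : View k₁ k₂ c) (v′ : View k₁ k₂ c′) → position v ≡ position v′ →
                       _≡_ {A = ∃ (View k₁ k₂)} (c , v) (c′ , v′)
  position-injective (inL i) (inL .i) refl = refl
  position-injective (inR j) (inR .j) refl = refl

  -- A view is determined by its position, and joint injectivity leaves one position over each cell.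
  -- Views are therefore unique, which gives both equations.
  mkSplitting : (∀ c → View k₁ k₂ c) → (∀ x y → [ k₁ , k₂ ] x ≡ [ k₁ , k₂ ] y → x ≡ y) →
                Splitting k₁ k₂
  mkSplitting view injective = record
    { view    = view
    ; view-k₁ = λ i → irrelevant _ _
    ; view-k₂ = λ j → irrelevant _ _
    }
    where
    irrelevant : ∀ {c} (v v′ : View k₁ k₂ c) → v ≡ v′
    irrelevant v v′
      with position-injective v v′ (injective _ _ (trans (lookup-position v) (sym (lookup-position v′))))
    ... | refl = refl

-- The composite

module Composite (S : Signature) {A B : Formula (Signature.Sort S)} {n m₁ m₂ : ℕ} {ℓ : Fin n → Operation S}
                 {k₁ : Fin m₁ → Fin n} {k₂ : Fin m₂ → Fin n} (splitting : Splitting k₁ k₂)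
                 (f : ProofNets.Linking S A B ℓ) (correct : ProofNets.Linking.Correct f) where
  open Signature S
  open ProofNets S
  open Operation
  open Absorption S A
  open Splitting splitting
  open Absorb S splitting f correct
  module C = Collection S A ℓ₁
  module F₁ = Linking C.collection

  f₁ : ProofNet A D
  f₁ = proofNet C.collection C.collection-correct

  f₂ : ProofNet D B
  f₂ = proofNet absorbed absorbed-correct

  ℓ⁺ : Fin m₁ ⊎ Fin m₂ → Operation S
  ℓ⁺ = glueLabel (diagram f₂) (diagram f₁)

  Outer₁ : ∀ {s t} → GPort A D ℓ₁ s t → GPort A B ℓ⁺ s t → Set
  Outer₁ = Outerᶠ (diagram f₂) (diagram f₁)

  Path₁ : ∀ {t u} → GPort A D ℓ₁ ⁻ t → GPort A B ℓ⁺ ⁺ u → Set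
  Path₁ = Pathᶠ (diagram f₂) (diagram f₁)

  Path₂ : ∀ {t u} → GPort D B ℓ₂ ⁻ t → GPort A B ℓ⁺ ⁺ u → Set
  Path₂ = Pathᵍ (diagram f₂) (diagram f₁)

  Glue : ∀ {t u} → GPort A B ℓ⁺ ⁻ t → GPort A B ℓ⁺ ⁺ u → Set
  Glue = GlueWire (diagram f₂) (diagram f₁)

  -- As the first factor only relays, each port of the composite has a counterpart among the ports
  -- of `f₂`, where its wire can be read off.
  place : ∀ {s t} → GPort A B ℓ⁺ s t → GPort D B ℓ₂ s t
  place (dom p)          = dom (port ℓ₁ (base p))
  place (cod p)          = cod p
  place (arg (inj₁ i) p) = dom (port ℓ₁ (arg i p))
  place (arg (inj₂ j) p) = arg j p
  place (res (inj₁ i) p) = dom (port ℓ₁ (res i p))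
  place (res (inj₂ j) p) = res j p

  outerPart : ∀ {s t} → Part ℓ₁ s t → GPort A B ℓ⁺ s t
  outerPart (base p)  = dom p
  outerPart (arg i p) = arg (inj₁ i) p
  outerPart (res i p) = res (inj₁ i) p

  place-outerPart : ∀ {s t} (x : Part ℓ₁ s t) → place (outerPart x) ≡ dom (port ℓ₁ x)
  place-outerPart (base p)  = refl
  place-outerPart (arg i p) = refl
  place-outerPart (res i p) = refl

  outer⇒outerPart : ∀ {s t} (x : Part ℓ₁ s t) {r} → Outer₁ (C.outerPort x) r → r ≡ outerPart x
  outer⇒outerPart (base p)  (dom .p)    = refl
  outer⇒outerPart (arg i p) (arg .i .p) = refl
  outer⇒outerPart (res i p) (res .i .p) = refl

  wire₁⇒across : ∀ {t u} {p : GPort A D ℓ₁ ⁻ t} {q : GPort A D ℓ₁ ⁺ u} → F₁.Wire p q →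
                 _≡_ {A = ∃[ v ] GPort A D ℓ₁ ⁺ v} (u , q) (t , C.across⁻ p)
  wire₁⇒across (F₁.sort refl) = refl
  wire₁⇒across (F₁.unit refl) = refl

  outerPort≢cod : ∀ {s t u} {x : Part ℓ₁ s t} {d : Port D s u} →
                  _≡_ {A = ∃[ v ] GPort A D ℓ₁ s v} (u , cod d) (t , C.outerPort x) → Empty
  outerPort≢cod {x = base _}  ()
  outerPort≢cod {x = arg _ _} ()
  outerPort≢cod {x = res _ _} ()

  exit-outer : ∀ {t} (d : Port D ⁻ t) {r} → Outer₁ (C.outerPort (part {s = ⁺} ℓ₁ d)) r →
               dom d ≡ place r
  exit-outer d o with outer⇒outerPart (part ℓ₁ d) o
  ... | refl = trans (cong dom (sym (port-part {s = ⁺} ℓ₁ d))) (sym (place-outerPart (part ℓ₁ d)))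

  -- A wire of f₁ at the middle formula leads straight out of it.
  exit : ∀ {t u} (d : Port D ⁻ t) {r : GPort A B ℓ⁺ ⁺ u} → Path₁ (cod d) r →
         _≡_ {A = ∃[ v ] GPort D B ℓ₂ ⁺ v} (t , dom d) (u , place r)
  exit d (stop (F₁.sort refl) o) = cong (_ ,_) (exit-outer d o)
  exit d (stop (F₁.unit refl) o) = cong (_ ,_) (exit-outer d o)
  exit d (cross w _) = ⊥-elim (outerPort≢cod {x = part {s = ⁺} ℓ₁ d} (wire₁⇒across w))

  -- After its wire of `f₂` a path either stops or is relayed once by `f₁`, and the relay ends at
  -- the port whose place is the target of that wire.
  path₂⇒wire : ∀ {t u} {p : GPort D B ℓ₂ ⁻ t} {r : GPort A B ℓ⁺ ⁺ u} → Path₂ p r → F₂.Wire p (place r)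
  path₂⇒wire (stop w (cod _))   = w
  path₂⇒wire (stop w (arg _ _)) = w
  path₂⇒wire (stop w (res _ _)) = w
  path₂⇒wire {p = p} (cross {d = d} w path) =
    subst (λ (_ , q) → F₂.Wire p q) (exit d path) w

  across-wire : ∀ {t} (x : Part ℓ₁ ⁻ t) → F₁.Wire (C.outerPort x) (cod (port ℓ₁ x))
  across-wire x = subst (F₁.Wire _) (C.across⁻-outer x) (C.wireAcross (C.outerPort x))

  exit-wire : ∀ {t} (x : Part ℓ₁ ⁺ t) → F₁.Wire (cod (port ℓ₁ x)) (C.outerPort x)
  exit-wire x = subst (F₁.Wire _) (cong C.outerPort (part-port ℓ₁ x)) (C.wireAcross (cod (port ℓ₁ x)))

  wire⇒path₂ : ∀ {t u} {p : GPort D B ℓ₂ ⁻ t} (r : GPort A B ℓ⁺ ⁺ u) → F₂.Wire p (place r) → Path₂ p r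
  wire⇒path₂ (dom p)          w = cross w (stop (exit-wire (base p)) (dom p))
  wire⇒path₂ (cod p)          w = stop w (cod p)
  wire⇒path₂ (arg (inj₁ i) p) w = cross w (stop (exit-wire (arg i p)) (arg i p))
  wire⇒path₂ (arg (inj₂ j) p) w = stop w (arg j p)
  wire⇒path₂ (res (inj₁ i) p) w = cross w (stop (exit-wire (res i p)) (res i p))
  wire⇒path₂ (res (inj₂ j) p) w = stop w (res j p)

  path₁⇒wire : ∀ {t u} (x : Part ℓ₁ ⁻ t) {r : GPort A B ℓ⁺ ⁺ u} → Path₁ (C.outerPort x) r →
               F₂.Wire (dom (port ℓ₁ x)) (place r)
  -- A wire of `f₁` that starts outside `D` ends in `D`, which is no outer port.
  path₁⇒wire x (stop w o) = ⊥-elim (no-stop x w o)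
    where
    no-stop : ∀ {t u} (x : Part ℓ₁ ⁻ t) {q : GPort A D ℓ₁ ⁺ u} {r} →
              F₁.Wire (C.outerPort x) q → Outer₁ q r → Empty
    no-stop (base _)  (F₁.sort refl) ()
    no-stop (base _)  (F₁.unit refl) ()
    no-stop (arg _ _) (F₁.sort refl) ()
    no-stop (arg _ _) (F₁.unit refl) ()
    no-stop (res _ _) (F₁.sort refl) ()
    no-stop (res _ _) (F₁.unit refl) ()
  path₁⇒wire x {r} (cross {d = d} w path) with trans (wire₁⇒across w) (cong (_ ,_) (C.across⁻-outer x))
  ... | refl = path₂⇒wire path

  glue⇒wire : ∀ {t u} {p : GPort A B ℓ⁺ ⁻ t} {r : GPort A B ℓ⁺ ⁺ u} →
              Glue p r → F₂.Wire (place p) (place r)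
  glue⇒wire (fromᶠ (dom p) path)   = path₁⇒wire (base p) path
  glue⇒wire (fromᶠ (arg i p) path) = path₁⇒wire (arg i p) path
  glue⇒wire (fromᶠ (res i p) path) = path₁⇒wire (res i p) path
  glue⇒wire (fromᵍ (cod p) path)   = path₂⇒wire path
  glue⇒wire (fromᵍ (arg j p) path) = path₂⇒wire path
  glue⇒wire (fromᵍ (res j p) path) = path₂⇒wire path

  wire⇒glue : ∀ {t u} (p : GPort A B ℓ⁺ ⁻ t) (r : GPort A B ℓ⁺ ⁺ u) →
              F₂.Wire (place p) (place r) → Glue p r
  wire⇒glue (dom p)          r w = fromᶠ (dom p) (cross (across-wire (base p)) (wire⇒path₂ r w))
  wire⇒glue (cod p)          r w = fromᵍ (cod p) (wire⇒path₂ r w)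
  wire⇒glue (arg (inj₁ i) p) r w = fromᶠ (arg i p) (cross (across-wire (arg i p)) (wire⇒path₂ r w))
  wire⇒glue (arg (inj₂ j) p) r w = fromᵍ (arg j p) (wire⇒path₂ r w)
  wire⇒glue (res (inj₁ i) p) r w = fromᶠ (res i p) (cross (across-wire (res i p)) (wire⇒path₂ r w))
  wire⇒glue (res (inj₂ j) p) r w = fromᵍ (res j p) (wire⇒path₂ r w)

  cells : Fin n ↔ (Fin m₁ ⊎ Fin m₂)
  cells = mk↔ₛ′ (position ⊚ view) [ k₁ , k₂ ]
    (λ { (inj₁ i) → cong position (view-k₁ i) ; (inj₂ j) → cong position (view-k₂ j) })
    (lookup-position ⊚ view)

  label-position : ∀ {c} (v : View k₁ k₂ c) → ℓ c ≡ ℓ⁺ (position v)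
  label-position (inL i) = refl
  label-position (inR j) = refl

  spread : ∀ {s t} → GPort A B ℓ s t → GPort A B ℓ⁺ s t
  spread = rename (position ⊚ view) (label-position ⊚ view)

  place-spread : ∀ {s t} (p : GPort A B ℓ s t) → place (spread p) ≡ into p
  place-spread (dom p)   = refl
  place-spread (cod p)   = refl
  place-spread (arg c p) with view c
  ... | inL i = refl
  ... | inR j = refl
  place-spread (res c p) with view c
  ... | inL i = refl
  ... | inR j = refl

  -- Both sides are compared with the wires of `f₂`: those of `f` through `into` and `outOf`, those
  -- of the composite through `place`.
  composite : diagram (proofNet f correct) ≅ (diagram f₂ ∘ᵈ diagram f₁)
  composite = record
    { cells  = cells
    ; labels = label-position ⊚ view
    ; wires  = λ p q → mk⇔
        (λ w → wire⇒glue (spread p) (spread q)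
                 (subst₂ F₂.Wire (sym (place-spread p)) (sym (place-spread q)) (intoWire w)))
        (λ g → subst₂ F.Wire (outOf-into p) (outOf-into q)
                 (outOfWire (subst₂ F₂.Wire (place-spread p) (place-spread q) (glue⇒wire g))))
    }

-- Enumerating the two sets of cells

member : ∀ {n} (C : Subset n) → Fin ∣ C ∣ → ∃ (_∈ˢ C)
member (inside  ∷ C) zero    = zero , here
member (inside  ∷ C) (suc i) = Product.map suc there (member C i)
member (outside ∷ C) i       = Product.map suc there (member C i)

rank : ∀ {n} {C : Subset n} → ∃ (_∈ˢ C) → Fin ∣ C ∣
rank (_ , here)                              = zero
rank {C = inside  ∷ _} (suc c , there c∈C)   = suc (rank (c , c∈C))
rank {C = outside ∷ _} (suc c , there c∈C)   = rank (c , c∈C)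

rank-member : ∀ {n} (C : Subset n) i → rank (member C i) ≡ i
rank-member (inside  ∷ C) zero    = refl
rank-member (inside  ∷ C) (suc i) = cong suc (rank-member C i)
rank-member (outside ∷ C) i       = rank-member C i

member-rank : ∀ {n} {C : Subset n} (x : ∃ (_∈ˢ C)) → member C (rank x) ≡ x
member-rank (_ , here)                            = refl
member-rank {C = inside  ∷ _} (suc c , there c∈C) =
  cong (Product.map suc there) (member-rank (c , c∈C))
member-rank {C = outside ∷ _} (suc c , there c∈C) =
  cong (Product.map suc there) (member-rank (c , c∈C))

members : ∀ {n} (C : Subset n) → Fin ∣ C ∣ ↔ ∃ (_∈ˢ C)
members C = mk↔ₛ′ (member C) rank member-rank (rank-member C)

member-injective : ∀ {n} (C : Subset n) {i j} → proj₁ (member C i) ≡ proj₁ (member C j) → i ≡ j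
member-injective C {i} {j} eq =
  trans (sym (rank-member C i)) (trans (cong rank (same (member C i) (member C j) eq)) (rank-member C j))
  where
  same : (x y : ∃ (_∈ˢ C)) → proj₁ x ≡ proj₁ y → x ≡ y
  same _ _ refl = cong (_ ,_) ([]=-irrelevant _ _)

-- Covering supplies a view of every cell, disjointness the joint injectivity of the two
-- enumerations.
splitting : ∀ {n} (C₁ C₂ : Subset n) → C₁ ∪ C₂ ≡ ⊤ → C₁ ∩ C₂ ≡ ⊥ →
            Splitting (proj₁ ⊚ member C₁) (proj₁ ⊚ member C₂)
splitting {n} C₁ C₂ cover disjoint = mkSplitting view λ where
    (inj₁ i) (inj₁ i′) eq → cong inj₁ (member-injective C₁ eq)
    (inj₁ i) (inj₂ j)  eq → ⊥-elim (apart i j eq)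
    (inj₂ j) (inj₁ i)  eq → ⊥-elim (apart i j (sym eq))
    (inj₂ j) (inj₂ j′) eq → cong inj₂ (member-injective C₂ eq)
  where
  V : Fin n → Set
  V = View (proj₁ ⊚ member C₁) (proj₁ ⊚ member C₂)

  view : ∀ c → V c
  view c with x∈p∪q⁻ C₁ C₂ (subst (c ∈ˢ_) (sym cover) ∈⊤)
  ... | inj₁ c∈C₁ = subst V (cong proj₁ (member-rank (c , c∈C₁))) (inL (rank (c , c∈C₁)))
  ... | inj₂ c∈C₂ = subst V (cong proj₁ (member-rank (c , c∈C₂))) (inR (rank (c , c∈C₂)))

  apart : ∀ i j → proj₁ (member C₁ i) ≢ proj₁ (member C₂ j)
  apart i j eq = ∉⊥ (subst (proj₁ (member C₁ i) ∈ˢ_) disjoint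
    (x∈p∩q⁺ (proj₂ (member C₁ i) , subst (_∈ˢ C₂) (sym eq) (proj₂ (member C₂ j)))))

proposition1 : (T : Theory) → let open Theory T in
    ∀ {A B} (f : ProofNet A B) (C₁ C₂ : Subset (ProofNet.size f)) →
    C₁ ∪ C₂ ≡ ⊤ → C₁ ∩ C₂ ≡ ⊥ →
    ∃[ D ] Σ[ f₁ ∈ ProofNet A D ] Σ[ f₂ ∈ ProofNet D B ]
    (f ≈ f₂ ∘ f₁ × HasExactlyCells f C₁ f₁ × HasExactlyCells f C₂ f₂)
proposition1 T f@(ProofNets.proofNet linking correct) C₁ C₂ cover disjoint =
  -- The net `f` itself represents the composite, which leaves an empty chain of theory steps. The
  -- labels agree by computation, being those of `f` read through the enumerations.
  _ , f₁ , f₂ , (f , composite , ε) , (members C₁ , λ _ → refl) , (members C₂ , λ _ → refl)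
  where open Composite (Theory.signature T) (splitting C₁ C₂ cover disjoint) linking correct
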